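{- Let $G$ be a connected $m$-vertex regular graph (with $m\ge 2$ finite) such that $\psi_G$ is not linear (i.e. not affine) on $[0,\log m]$. Then, for every positive integer $n$, $i_a(G^n)$ is not linear in $\log a$; that is, there are no real constants $c, C$ such that $i_a(G^n)=c\cdot\log(m^n/a)+C$ for all $a\in[m^n]$. Moreover, there are connected regular graphs $G$ for which $\psi_G$ is not linear; for example, this is the case when $G=C_m$ is the cycle with $m\ge 5$ vertices.
   Context: $\log$ is the natural logarithm and $[m]$ denotes $\{1,\dots,m\}$. For a graph $G$ and $A\subseteq V(G)$, $A^c = V(G)\setminus A$ and $e_G(A,A^c)$ is the number of edges of $G$ with exactly one endpoint in $A$. For an $m$-vertex graph $G$ and $k\in[m]$, $i_k(G) := \min\{e_G(A,A^c)/|A| : A\subseteq V(G),\ |A|=k\}$. The function $\psi_G\colon[0,\log m]\to[0,\infty)$ is the convex minorant of the points $(\log k, i_k(G))$, i.e. the largest convex function on $[0,\log m]$ satisfying $\psi_G(\log k)\le i_k(G)$ for all $k\in[m]$. $G^n$ denotes the product graph $G\square\cdots\square G$ ($n$ copies): its vertex set is $V(G)^n$ and its edges are all pairs $\{u,v\}$ for which there is an index $j\in[n]$ such that $u_jv_j\in E(G)$ and $u_l=v_l$ for all $l\neq j$. -}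

module Defs where

open import Level using (0ℓ)
open import Data.Nat.Base as ℕ using (ℕ; zero; suc; NonZero; z≤n; s≤s)
import Data.Nat.Properties as ℕ
open import Data.Integer.Base as ℤ using (+_; +[1+_])
import Data.Integer.Properties as ℤ
open import Data.Rational.Unnormalised as ℚ using (ℚᵘ; mkℚᵘ; 0ℚᵘ; 1ℚᵘ; *≤*; *<*; *≡*)
import Data.Rational.Unnormalised.Properties as ℚ
open import Data.Rational.Unnormalised.Solver using (module +-*-Solver)
open import Data.Fin.Base as Fin using (Fin; toℕ; finToFun)
import Data.Fin.Properties as Fin
open import Data.Fin.Subset using (Subset; inside; outside; _∈_; ∁; ∣_∣)
open import Data.Fin.Subset.Properties using (_∈?_)
open import Data.Vec.Base using ([]; _∷_)
open import Data.List.Base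
  using (List; []; _∷_; _++_; map; filter; length; allFin; cartesianProduct)
open import Data.Product using (∃-syntax; Σ-syntax; _×_; _,_)
open import Data.Sum using (_⊎_; inj₁; inj₂; swap)
open import Relation.Nullary using (¬_; ¬?; contradiction)
open import Relation.Nullary.Decidable using (_×-dec_; _⊎-dec_; _→-dec_)
open import Relation.Binary using (Rel; Decidable; Symmetric; Irreflexive)
open import Relation.Binary.Construct.Closure.ReflexiveTransitive using (Star)
open import Relation.Binary.PropositionalEquality
  using (_≡_; _≢_; refl; sym; trans; cong; subst)

-- The real numbers are the Cauchy sequences of rationals, up to _≈_.

IsCauchy : (ℕ → ℚᵘ) → Set
IsCauchy s = ∀ ε → 0ℚᵘ ℚ.< ε →
  ∃[ N ] (∀ m n → N ℕ.≤ m → N ℕ.≤ n → ℚ.∣ s m ℚ.- s n ∣ ℚ.≤ ε)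

record ℝ : Set where
  constructor mkℝ
  field
    seq    : ℕ → ℚᵘ
    cauchy : IsCauchy seq

open ℝ public

infix 4 _≈_ _≤_

record _≈_ (x y : ℝ) : Set where
  constructor mk≈
  field
    close : ∀ ε → 0ℚᵘ ℚ.< ε →
      ∃[ N ] (∀ n → N ℕ.≤ n → ℚ.∣ seq x n ℚ.- seq y n ∣ ℚ.≤ ε)

record _≤_ (x y : ℝ) : Set where
  constructor mk≤
  field
    bound : ∀ ε → 0ℚᵘ ℚ.< ε →
      ∃[ N ] (∀ n → N ℕ.≤ n → seq x n ℚ.≤ seq y n ℚ.+ ε)

module RingIdentities where
  open +-*-Solver

  plus-minus : ∀ a b c d → (a ℚ.+ b) ℚ.- (c ℚ.+ d) ℚ.≃ (a ℚ.- c) ℚ.+ (b ℚ.- d)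
  plus-minus = solve 4 (λ a b c d → (a :+ b) :- (c :+ d) := (a :- c) :+ (b :- d)) ℚ.≃-refl

  neg-neg : ∀ a b → (ℚ.- a) ℚ.- (ℚ.- b) ℚ.≃ b ℚ.- a
  neg-neg = solve 2 (λ a b → (:- a) :- (:- b) := b :- a) ℚ.≃-refl

  minus-plus : ∀ a b → a ℚ.≃ (a ℚ.- b) ℚ.+ b
  minus-plus = solve 2 (λ a b → a := (a :- b) :+ b) ℚ.≃-refl

  times-minus : ∀ a b c d → a ℚ.* b ℚ.- c ℚ.* d ℚ.≃ a ℚ.* (b ℚ.- d) ℚ.+ d ℚ.* (a ℚ.- c)
  times-minus = solve 4 (λ a b c d → a :* b :- c :* d := a :* (b :- d) :+ d :* (a :- c)) ℚ.≃-refl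

  swap-last : ∀ x y z → x ℚ.+ (y ℚ.+ z) ℚ.≃ (x ℚ.+ z) ℚ.+ y
  swap-last = solve 3 (λ x y z → x :+ (y :+ z) := (x :+ z) :+ y) ℚ.≃-refl

  assoc-swap : ∀ x y z → (x ℚ.+ z) ℚ.+ y ℚ.≃ x ℚ.+ (y ℚ.+ z)
  assoc-swap = solve 3 (λ x y z → (x :+ z) :+ y := x :+ (y :+ z)) ℚ.≃-refl

  add-both : ∀ x y z → x ℚ.- y ℚ.≃ (x ℚ.+ z) ℚ.- (y ℚ.+ z)
  add-both = solve 3 (λ x y z → x :- y := (x :+ z) :- (y :+ z)) ℚ.≃-refl

  plus-minus-comm : ∀ x y z → (x ℚ.+ z) ℚ.- y ℚ.≃ (x ℚ.- y) ℚ.+ z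
  plus-minus-comm = solve 3 (λ x y z → (x :+ z) :- y := (x :- y) :+ z) ℚ.≃-refl

  minus-cancel : ∀ x y z → (x ℚ.- (y ℚ.+ z)) ℚ.+ z ℚ.≃ x ℚ.- y
  minus-cancel = solve 3 (λ x y z → (x :- (y :+ z)) :+ z := x :- y) ℚ.≃-refl

  plus-minus-cancel : ∀ x d → (x ℚ.+ d) ℚ.- x ℚ.≃ d
  plus-minus-cancel = solve 2 (λ x d → (x :+ d) :- x := d) ℚ.≃-refl

  telescope : ∀ a b c → a ℚ.- c ℚ.≃ (a ℚ.- b) ℚ.+ (b ℚ.- c)
  telescope = solve 3 (λ a b c → a :- c := (a :- b) :+ (b :- c)) ℚ.≃-refl

  neg-minus : ∀ a b → ℚ.- (a ℚ.- b) ℚ.≃ b ℚ.- a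
  neg-minus = solve 2 (λ a b → :- (a :- b) := b :- a) ℚ.≃-refl

  cancel-minus : ∀ a b c → (a ℚ.- c) ℚ.- (b ℚ.- c) ℚ.≃ a ℚ.- b
  cancel-minus = solve 3 (λ a b c → (a :- c) :- (b :- c) := a :- b) ℚ.≃-refl

open RingIdentities

module CauchyProofs where

  half : ℚᵘ → ℚᵘ
  half ε = ℚ.½ ℚ.* ε

  half-pos : ∀ ε → 0ℚᵘ ℚ.< ε → 0ℚᵘ ℚ.< half ε
  half-pos ε p = ℚ.positive⁻¹ (half ε)
    {{ℚ.pos*pos⇒pos ℚ.½ ε {{ℚ.positive p}}}}

  half+half : ∀ ε → half ε ℚ.+ half ε ℚ.≃ ε
  half+half ε =
    ℚ.≃-trans (ℚ.≃-sym (ℚ.*-distribʳ-+ ε ℚ.½ ℚ.½))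
      (ℚ.≃-trans (ℚ.*-congʳ {ε} {ℚ.½ ℚ.+ ℚ.½} {1ℚᵘ} (*≡* refl)) (ℚ.*-identityˡ ε))

  ∣∣-resp : ∀ a b {ε} → a ℚ.≃ b → ℚ.∣ b ∣ ℚ.≤ ε → ℚ.∣ a ∣ ℚ.≤ ε
  ∣∣-resp a b e h = ℚ.≤-trans (ℚ.≤-reflexive (ℚ.∣-∣-cong {a} {b} e)) h

  tri : ∀ a b c {ε δ η} → c ℚ.≃ a ℚ.+ b → ε ℚ.+ δ ℚ.≃ η →
        ℚ.∣ a ∣ ℚ.≤ ε → ℚ.∣ b ∣ ℚ.≤ δ → ℚ.∣ c ∣ ℚ.≤ η
  tri a b c e f p q = ∣∣-resp c (a ℚ.+ b) e
    (ℚ.≤-trans (ℚ.∣p+q∣≤∣p∣+∣q∣ a b)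
      (ℚ.≤-trans (ℚ.+-mono-≤ p q) (ℚ.≤-reflexive f)))

  subst-close : ∀ a b a' b' {ε} → a ℚ.≃ a' → b ℚ.≃ b' →
                ℚ.∣ a ℚ.- b ∣ ℚ.≤ ε → ℚ.∣ a' ℚ.- b' ∣ ℚ.≤ ε
  subst-close a b a' b' p q =
    ∣∣-resp (a' ℚ.- b') (a ℚ.- b) (ℚ.+-cong (ℚ.≃-sym p) (ℚ.-‿cong (ℚ.≃-sym q)))

  ∣∣-sym : ∀ a b {ε} → ℚ.∣ a ℚ.- b ∣ ℚ.≤ ε → ℚ.∣ b ℚ.- a ∣ ℚ.≤ ε
  ∣∣-sym a b h = ℚ.≤-trans
    (ℚ.≤-reflexive (ℚ.≃-trans (ℚ.∣-∣-cong {b ℚ.- a} {ℚ.- (a ℚ.- b)} (ℚ.≃-sym (neg-minus a b)))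
      (ℚ.∣-p∣≃∣p∣ (a ℚ.- b)))) h

  Close : (ℕ → ℚᵘ) → ℚᵘ → Set
  Close s ε = ∃[ N ] (∀ m n → N ℕ.≤ m → N ℕ.≤ n → ℚ.∣ s m ℚ.- s n ∣ ℚ.≤ ε)

  +-close : ∀ s t ε → Close s (half ε) → Close t (half ε) → Close (λ n → s n ℚ.+ t n) ε
  +-close s t ε (N , f) (M , g) = N ℕ.+ M , λ m n hm hn →
    tri (s m ℚ.- s n) (t m ℚ.- t n) ((s m ℚ.+ t m) ℚ.- (s n ℚ.+ t n))
      (plus-minus (s m) (t m) (s n) (t n)) (half+half ε)
      (f m n (ℕ.m+n≤o⇒m≤o N hm) (ℕ.m+n≤o⇒m≤o N hn))
      (g m n (ℕ.m+n≤o⇒n≤o N hm) (ℕ.m+n≤o⇒n≤o N hn))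

  neg-close : ∀ s ε → Close s ε → Close (λ n → ℚ.- s n) ε
  neg-close s ε (N , f) = N , λ m n hm hn →
    ∣∣-resp (ℚ.- s m ℚ.- ℚ.- s n) (s n ℚ.- s m) (neg-neg (s m) (s n)) (f n m hn hm)

  Bounded : (ℕ → ℚᵘ) → Set
  Bounded s = Σ[ N ∈ ℕ ] Σ[ B ∈ ℚᵘ ]
    (0ℚᵘ ℚ.< B × (∀ n → N ℕ.≤ n → ℚ.∣ s n ∣ ℚ.≤ B))

  bounded : ∀ s → Close s 1ℚᵘ → Bounded s
  bounded s (N , f) = N , 1ℚᵘ ℚ.+ ℚ.∣ s N ∣
    , ℚ.<-≤-trans (ℚ.positive⁻¹ 1ℚᵘ) (ℚ.p≤p+q 1ℚᵘ ℚ.∣ s N ∣ {{ℚ.∣-∣-nonNeg (s N)}})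
    , λ n h → tri (s n ℚ.- s N) (s N) (s n) (minus-plus (s n) (s N)) ℚ.≃-refl
        (f n N h ℕ.≤-refl) ℚ.≤-refl

  abs-*-mono : ∀ a b B δ → ℚ.∣ a ∣ ℚ.≤ B → ℚ.∣ b ∣ ℚ.≤ δ → ℚ.∣ a ℚ.* b ∣ ℚ.≤ B ℚ.* δ
  abs-*-mono a b B δ p q =
    ℚ.≤-trans (ℚ.≤-reflexive (ℚ.∣p*q∣≃∣p∣*∣q∣ a b))
      (ℚ.*-mono-≤-nonNeg {ℚ.∣ a ∣} {B} {ℚ.∣ b ∣} {δ}
        {{ℚ.∣-∣-nonNeg a}} {{ℚ.∣-∣-nonNeg b}} p q)

  share : ∀ B C ε → 0ℚᵘ ℚ.< B → 0ℚᵘ ℚ.< C → 0ℚᵘ ℚ.< ε →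
    Σ[ δ ∈ ℚᵘ ] (0ℚᵘ ℚ.< δ × B ℚ.* δ ℚ.+ C ℚ.* δ ℚ.≃ ε)
  share B C ε B>0 C>0 ε>0 = δ
    , ℚ.positive⁻¹ δ
        {{ℚ.pos*pos⇒pos (ℚ.1/ D) {{ℚ.1/pos⇒pos D {{D-pos}}}} ε {{ℚ.positive ε>0}}}}
    , ℚ.≃-trans (ℚ.≃-sym (ℚ.*-distribʳ-+ δ B C))
        (ℚ.≃-trans (ℚ.≃-sym (ℚ.*-assoc D (ℚ.1/ D) ε))
          (ℚ.≃-trans (ℚ.*-congʳ {ε} {D ℚ.* ℚ.1/ D} {1ℚᵘ} (ℚ.*-inverseʳ D)) (ℚ.*-identityˡ ε)))
    where
    D = B ℚ.+ C
    D-pos : ℚ.Positive D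
    D-pos = ℚ.pos+pos⇒pos B {{ℚ.positive B>0}} C {{ℚ.positive C>0}}
    instance
      D-nz : ℚ.NonZero D
      D-nz = ℚ.pos⇒nonZero D {{D-pos}}
    δ = ℚ.1/ D ℚ.* ε

  *-close : ∀ s t N₁ N₂ B C δ ε → B ℚ.* δ ℚ.+ C ℚ.* δ ℚ.≃ ε →
    (∀ n → N₁ ℕ.≤ n → ℚ.∣ s n ∣ ℚ.≤ B) → (∀ n → N₂ ℕ.≤ n → ℚ.∣ t n ∣ ℚ.≤ C) →
    Close s δ → Close t δ → Close (λ n → s n ℚ.* t n) ε
  *-close s t N₁ N₂ B C δ ε e hB hC (N₃ , f) (N₄ , g) =
    (N₁ ℕ.+ N₂) ℕ.+ (N₃ ℕ.+ N₄) , λ m n hm hn →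
      tri (s m ℚ.* (t m ℚ.- t n)) (t n ℚ.* (s m ℚ.- s n)) (s m ℚ.* t m ℚ.- s n ℚ.* t n)
        (times-minus (s m) (t m) (s n) (t n)) e
        (abs-*-mono (s m) (t m ℚ.- t n) B δ
          (hB m (ℕ.m+n≤o⇒m≤o N₁ (left hm)))
          (g m n (ℕ.m+n≤o⇒n≤o N₃ (right hm)) (ℕ.m+n≤o⇒n≤o N₃ (right hn))))
        (abs-*-mono (t n) (s m ℚ.- s n) C δ
          (hC n (ℕ.m+n≤o⇒n≤o N₁ (left hn)))
          (f m n (ℕ.m+n≤o⇒m≤o N₃ (right hm)) (ℕ.m+n≤o⇒m≤o N₃ (right hn))))
    where
    left : ∀ {n} → (N₁ ℕ.+ N₂) ℕ.+ (N₃ ℕ.+ N₄) ℕ.≤ n → N₁ ℕ.+ N₂ ℕ.≤ n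
    left = ℕ.m+n≤o⇒m≤o (N₁ ℕ.+ N₂)
    right : ∀ {n} → (N₁ ℕ.+ N₂) ℕ.+ (N₃ ℕ.+ N₄) ℕ.≤ n → N₃ ℕ.+ N₄ ℕ.≤ n
    right = ℕ.m+n≤o⇒n≤o (N₁ ℕ.+ N₂)

  abstract
    const-cauchy : ∀ q → IsCauchy (λ _ → q)
    const-cauchy q ε ε>0 = 0 , λ _ _ _ _ →
      ∣∣-resp (q ℚ.- q) 0ℚᵘ (ℚ.+-inverseʳ q) (ℚ.<⇒≤ ε>0)

    +-cauchy : ∀ s t → IsCauchy s → IsCauchy t → IsCauchy (λ n → s n ℚ.+ t n)
    +-cauchy s t cs ct ε ε>0 =
      +-close s t ε (cs (half ε) (half-pos ε ε>0)) (ct (half ε) (half-pos ε ε>0))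

    neg-cauchy : ∀ s → IsCauchy s → IsCauchy (λ n → ℚ.- s n)
    neg-cauchy s cs ε ε>0 = neg-close s ε (cs ε ε>0)

    *-cauchy : ∀ s t → IsCauchy s → IsCauchy t → IsCauchy (λ n → s n ℚ.* t n)
    *-cauchy s t cs ct ε ε>0 =
      let 0<1 = ℚ.positive⁻¹ 1ℚᵘ
          (N₁ , B , B>0 , hB) = bounded s (cs 1ℚᵘ 0<1)
          (N₂ , C , C>0 , hC) = bounded t (ct 1ℚᵘ 0<1)
          (δ , δ>0 , e)       = share B C ε B>0 C>0 ε>0
      in *-close s t N₁ N₂ B C δ ε e hB hC (cs δ δ>0) (ct δ δ>0)

open CauchyProofs

infixl 6 _+_ _-_
infixl 7 _*_

_+_ _-_ _*_ : ℝ → ℝ → ℝ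
x + y = mkℝ (λ n → seq x n ℚ.+ seq y n)
  (+-cauchy (seq x) (seq y) (cauchy x) (cauchy y))
x - y = mkℝ (λ n → seq x n ℚ.- seq y n)
  (+-cauchy (seq x) _ (cauchy x) (neg-cauchy (seq y) (cauchy y)))
x * y = mkℝ (λ n → seq x n ℚ.* seq y n)
  (*-cauchy (seq x) (seq y) (cauchy x) (cauchy y))

fromℚ : ℚᵘ → ℝ
fromℚ q = mkℝ (λ _ → q) (const-cauchy q)

0ℝ 1ℝ : ℝ
0ℝ = fromℚ 0ℚᵘ
1ℝ = fromℚ 1ℚᵘ

harmonic : ℕ → ℚᵘ
harmonic zero    = 0ℚᵘ
harmonic (suc n) = harmonic n ℚ.+ (+ 1 ℚ./ suc n)

-- For p ≥ q this is Σ_{qN < j ≤ pN} 1/j = Σ (1/(qN)) · 1/(j/(qN)), the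
-- right-endpoint Riemann sum of mesh 1/(qN) for ∫₁^{p/q} dt/t (and minus the
-- corresponding sum for ∫_{p/q}^1 dt/t when p < q).
logSeq : (p q : ℕ) → ℕ → ℚᵘ
logSeq p q N = harmonic (p ℕ.* N) ℚ.- harmonic (q ℕ.* N)

module LogProofs where
  nat : ℕ → ℚᵘ
  nat k = + k ℚ./ 1

  inv : (k : ℕ) → .{{NonZero k}} → ℚᵘ
  inv k = + 1 ℚ./ k

  nat-suc : ∀ k r → nat (suc k) ℚ.* r ℚ.≃ r ℚ.+ nat k ℚ.* r
  nat-suc k r =
    ℚ.≃-trans (ℚ.*-congʳ {r} {nat (suc k)} {1ℚᵘ ℚ.+ nat k} (*≡* eq))
      (ℚ.≃-trans (ℚ.*-distribʳ-+ r 1ℚᵘ (nat k)) (ℚ.+-congˡ _ (ℚ.*-identityˡ r)))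
    where
    eq : + suc k ℤ.* + 1 ≡ (+ 1 ℤ.* + 1 ℤ.+ + k ℤ.* + 1) ℤ.* + 1
    eq = cong (ℤ._* + 1) (cong (λ z → + 1 ℤ.+ z) (sym (ℤ.*-identityʳ (+ k))))

  inv-anti : ∀ {a b} .{{_ : NonZero a}} .{{_ : NonZero b}} → a ℕ.≤ b → inv b ℚ.≤ inv a
  inv-anti {suc a} {suc b} h = *≤* (ℤ.*-monoˡ-≤-nonNeg (+ 1) (ℤ.+≤+ h))

  nat*inv : ∀ k n → nat (suc k) ℚ.* inv (suc k ℕ.* suc n) ℚ.≃ inv (suc n)
  nat*inv k n = *≡* (cong +_ eq)
    where
    M = suc k ℕ.* suc n
    eq : (suc k ℕ.* 1) ℕ.* suc n ≡ 1 ℕ.* (1 ℕ.* M)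
    eq = trans (cong (ℕ._* suc n) (ℕ.*-identityʳ (suc k)))
      (sym (trans (ℕ.*-identityˡ (1 ℕ.* M)) (ℕ.*-identityˡ M)))

  block-lower : ∀ a b .{{_ : NonZero b}} j → j ℕ.+ a ℕ.≤ b →
    harmonic a ℚ.+ nat j ℚ.* inv b ℚ.≤ harmonic (j ℕ.+ a)
  block-lower a b zero    h =
    ℚ.≤-reflexive (ℚ.≃-trans (ℚ.+-congʳ (harmonic a) (ℚ.*-zeroˡ (inv b))) (ℚ.+-identityʳ _))
  block-lower a b (suc j) h =
    ℚ.≤-trans
      (ℚ.≤-reflexive (ℚ.≃-trans (ℚ.+-congʳ (harmonic a) (nat-suc j (inv b)))
        (swap-last
          (harmonic a) (inv b) (nat j ℚ.* inv b))))
      (ℚ.+-mono-≤ (block-lower a b j (ℕ.≤-trans (ℕ.n≤1+n _) h)) (inv-anti h))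

  block-upper : ∀ a .{{_ : NonZero a}} j →
    harmonic (j ℕ.+ a) ℚ.≤ harmonic a ℚ.+ nat j ℚ.* inv a
  block-upper a zero    =
    ℚ.≤-reflexive (ℚ.≃-sym
      (ℚ.≃-trans (ℚ.+-congʳ (harmonic a) (ℚ.*-zeroˡ (inv a))) (ℚ.+-identityʳ _)))
  block-upper a (suc j) =
    ℚ.≤-trans (ℚ.+-mono-≤ (block-upper a j) (inv-anti (ℕ.m≤n⇒m≤1+n (ℕ.m≤n+m a j))))
      (ℚ.≤-reflexive (ℚ.≃-trans
        (assoc-swap
          (harmonic a) (inv a) (nat j ℚ.* inv a))
        (ℚ.+-congʳ (harmonic a) (ℚ.≃-sym (nat-suc j (inv a))))))

  -- For N ≥ 1, u k N increases with N and u k N + 1/N decreases.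
  u : ℕ → ℕ → ℚᵘ
  u k N = harmonic (suc k ℕ.* N) ℚ.- harmonic N

  u-mono : ∀ k n → u k (suc n) ℚ.≤ u k (suc (suc n))
  u-mono k n = ℚ.≤-trans (ℚ.≤-reflexive eq)
    (ℚ.+-monoˡ-≤ (ℚ.- harmonic (suc (suc n)))
      (subst (λ z → harmonic a ℚ.+ inv (suc (suc n)) ℚ.≤ harmonic z) (sym e)
        (ℚ.≤-trans (ℚ.+-monoʳ-≤ (harmonic a) (ℚ.≤-reflexive (ℚ.≃-sym (nat*inv k (suc n)))))
          (block-lower a (suc k ℕ.* suc (suc n)) (suc k) (ℕ.≤-reflexive (sym e))))))
    where
    a = suc k ℕ.* suc n
    e : suc k ℕ.* suc (suc n) ≡ suc k ℕ.+ a
    e = ℕ.*-suc (suc k) (suc n)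
    eq : u k (suc n) ℚ.≃ (harmonic a ℚ.+ inv (suc (suc n))) ℚ.- harmonic (suc (suc n))
    eq = add-both
      (harmonic a) (harmonic (suc n)) (inv (suc (suc n)))

  u-anti : ∀ k n → u k (suc (suc n)) ℚ.+ inv (suc (suc n)) ℚ.≤ u k (suc n) ℚ.+ inv (suc n)
  u-anti k n = ℚ.≤-trans (ℚ.≤-reflexive eq)
    (ℚ.≤-trans
      (ℚ.+-monoˡ-≤ (ℚ.- harmonic (suc n))
        (subst (λ z → harmonic z ℚ.≤ harmonic a ℚ.+ inv (suc n)) (sym e)
          (ℚ.≤-trans (block-upper a (suc k))
            (ℚ.+-monoʳ-≤ (harmonic a) (ℚ.≤-reflexive (nat*inv k n))))))
      (ℚ.≤-reflexive
        (plus-minus-comm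
          (harmonic a) (harmonic (suc n)) (inv (suc n)))))
    where
    a = suc k ℕ.* suc n
    e : suc k ℕ.* suc (suc n) ≡ suc k ℕ.+ a
    e = ℕ.*-suc (suc k) (suc n)
    h' = harmonic (suc k ℕ.* suc (suc n))
    eq : u k (suc (suc n)) ℚ.+ inv (suc (suc n)) ℚ.≃ h' ℚ.- harmonic (suc n)
    eq = minus-cancel
      h' (harmonic (suc n)) (inv (suc (suc n)))

  u-mono* : ∀ k n d → u k (suc n) ℚ.≤ u k (d ℕ.+ suc n)
  u-mono* k n zero    = ℚ.≤-refl
  u-mono* k n (suc d) = ℚ.≤-trans (u-mono* k n d)
    (subst (λ z → u k z ℚ.≤ u k (suc z)) (sym (ℕ.+-suc d n)) (u-mono k (d ℕ.+ n)))

  u-anti* : ∀ k n d .{{_ : NonZero (d ℕ.+ suc n)}} →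
    u k (d ℕ.+ suc n) ℚ.+ inv (d ℕ.+ suc n) ℚ.≤ u k (suc n) ℚ.+ inv (suc n)
  u-anti* k n zero    = ℚ.≤-refl
  u-anti* k n (suc d) = ℚ.≤-trans (step (d ℕ.+ suc n) (ℕ.+-suc d n) {{nz}})
    (u-anti* k n d {{nz}})
    where
    nz : NonZero (d ℕ.+ suc n)
    nz = ℕ.≢-nonZero λ z → ℕ.1+n≢0 (trans (sym (ℕ.+-suc d n)) z)
    step : ∀ z → z ≡ suc (d ℕ.+ n) → .{{_ : NonZero z}} →
      u k (suc z) ℚ.+ inv (suc z) ℚ.≤ u k z ℚ.+ inv z
    step .(suc (d ℕ.+ n)) refl = u-anti k (d ℕ.+ n)

  abs-between : ∀ {x y δ} → x ℚ.≤ y → y ℚ.≤ x ℚ.+ δ → ℚ.∣ y ℚ.- x ∣ ℚ.≤ δ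
  abs-between {x} {y} {δ} p q =
    ℚ.≤-trans (ℚ.≤-reflexive (ℚ.0≤p⇒∣p∣≃p (ℚ.p≤q⇒0≤q-p p)))
      (ℚ.≤-trans (ℚ.+-monoˡ-≤ (ℚ.- x) q)
        (ℚ.≤-reflexive (plus-minus-cancel x δ)))

  u-close : ∀ k n m → suc n ℕ.≤ m → ℚ.∣ u k m ℚ.- u k (suc n) ∣ ℚ.≤ inv (suc n)
  u-close k n m h =
    subst (λ z → ℚ.∣ u k z ℚ.- u k (suc n) ∣ ℚ.≤ inv (suc n)) (ℕ.m∸n+n≡m h)
      (abs-between (u-mono* k n d)
        (ℚ.≤-trans (ℚ.p≤p+q _ (inv (d ℕ.+ suc n) {{nz}}) {{inv-nonNeg _ {{nz}}}})
          (u-anti* k n d {{nz}})))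
    where
    d = m ℕ.∸ suc n
    nz : NonZero (d ℕ.+ suc n)
    nz = ℕ.≢-nonZero λ z → ℕ.1+n≢0 (trans (sym (ℕ.+-suc d n)) z)
    inv-nonNeg : ∀ b .{{_ : NonZero b}} → ℚ.NonNegative (inv b)
    inv-nonNeg (suc b) = _

  archimedean : ∀ ε → 0ℚᵘ ℚ.< ε → ∃[ n ] inv (suc n) ℚ.≤ ε
  archimedean (mkℚᵘ +[1+ a ] d) _ = d , *≤* (ℤ.*-monoʳ-≤-nonNeg (+ suc d) {+ 1} {+[1+ a ]} (ℤ.+≤+ (s≤s z≤n)))
  archimedean (mkℚᵘ (+ zero) d) (*<* (ℤ.+<+ ()))
  archimedean (mkℚᵘ ℤ.-[1+ a ] d) (*<* ())

  u-cauchy : ∀ k → IsCauchy (u k)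
  u-cauchy k ε ε>0 = go (archimedean (half ε) (half-pos ε ε>0))
    where
    go : ∃[ n ] inv (suc n) ℚ.≤ half ε → Close (u k) ε
    go (n , h) = suc n , λ i j hi hj →
      tri (u k i ℚ.- u k (suc n)) (u k (suc n) ℚ.- u k j) (u k i ℚ.- u k j)
        (telescope (u k i) (u k (suc n)) (u k j)) (half+half ε)
        (ℚ.≤-trans (u-close k n i hi) h)
        (∣∣-sym (u k j) (u k (suc n)) (ℚ.≤-trans (u-close k n j hj) h))

  logSeq-close : ∀ p q ε → Close (λ n → u p n ℚ.- u q n) ε →
                 Close (logSeq (suc p) (suc q)) ε
  logSeq-close p q ε (N , f) = N , λ m n hm hn →
    subst-close (u p m ℚ.- u q m) (u p n ℚ.- u q n)
      (logSeq (suc p) (suc q) m) (logSeq (suc p) (suc q) n)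
      (eq m) (eq n) (f m n hm hn)
    where
    eq : ∀ n → u p n ℚ.- u q n ℚ.≃ logSeq (suc p) (suc q) n
    eq n = cancel-minus (harmonic (suc p ℕ.* n)) (harmonic (suc q ℕ.* n)) (harmonic n)

  abstract
    logSeq-cauchy : ∀ p q → IsCauchy (logSeq (suc p) (suc q))
    logSeq-cauchy p q ε ε>0 = logSeq-close p q ε
      (+-cauchy (u p) (λ n → ℚ.- u q n) (u-cauchy p) (neg-cauchy (u q) (u-cauchy q)) ε ε>0)

open LogProofs using (logSeq-cauchy)

-- The natural logarithm log x = ∫₁ˣ dt/t at rational x > 0, as the limit of
-- the Riemann sums logSeq; junk value 0 at x ≤ 0.
log : ℚᵘ → ℝ
log (mkℚᵘ +[1+ p ] q) = mkℝ (logSeq (suc p) (suc q)) (logSeq-cauchy p q)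
log _                 = 0ℝ

-- The vertices of an m-vertex graph are labelled by Fin m.
record Graph (m : ℕ) : Set₁ where
  field
    Adj    : Rel (Fin m) 0ℓ
    adj?   : Decidable Adj
    symm   : Symmetric Adj
    irrefl : Irreflexive _≡_ Adj

module _ {m : ℕ} (G : Graph m) where
  open Graph G

  degree : Fin m → ℕ
  degree v = length (filter (adj? v) (allFin m))

  Regular : Set
  Regular = ∃[ d ] (∀ v → degree v ≡ d)

  Connected : Set
  Connected = Fin m × (∀ u v → Star Adj u v)

  -- An edge with exactly one endpoint in A corresponds to exactly one
  -- ordered pair (u , v) with u ∈ A and v ∈ ∁ A.
  boundary : Subset m → ℕ
  boundary A = length (filter
    (λ (u , v) → (u ∈? A) ×-dec (v ∈? ∁ A) ×-dec adj? u v)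
    (cartesianProduct (allFin m) (allFin m)))

-- The vertex set V^n = (Fin n → Fin m) is coded as Fin (m ^ n) by finToFun.
infix 8 _□^_
_□^_ : ∀ {m} → Graph m → (n : ℕ) → Graph (m ℕ.^ n)
_□^_ {m} G n = record
  { Adj    = λ u v → Edge (finToFun u) (finToFun v)
  ; adj?   = λ u v → Fin.any? λ j →
      adj? (finToFun u j) (finToFun v j)
      ×-dec Fin.all? λ l → ¬? (l Fin.≟ j) →-dec (finToFun u l Fin.≟ finToFun v l)
  ; symm   = λ (j , e , f) → j , symm e , λ l l≢j → sym (f l l≢j)
  ; irrefl = λ { {u} refl (j , e , _) → irrefl refl e }
  }
  where
  open Graph G using (Adj; adj?; symm; irrefl)
  Edge : (x y : Fin n → Fin m) → Set
  Edge x y = ∃[ j ] (Adj (x j) (y j) × (∀ l → l ≢ j → x l ≡ y l))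

Next : ∀ {m} → Rel (Fin m) 0ℓ
Next {m} u v = (suc (toℕ u) ≡ toℕ v) ⊎ (suc (toℕ u) ≡ m × toℕ v ≡ 0)

cycle : (m : ℕ) → 3 ℕ.≤ m → Graph m
cycle m 3≤m = record
  { Adj    = λ u v → Next u v ⊎ Next v u
  ; adj?   = λ u v → next? u v ⊎-dec next? v u
  ; symm   = swap
  ; irrefl = λ { refl (inj₁ e) → ¬loop e ; refl (inj₂ e) → ¬loop e }
  }
  where
  next? : Decidable (Next {m})
  next? u v = (suc (toℕ u) ℕ.≟ toℕ v) ⊎-dec ((suc (toℕ u) ℕ.≟ m) ×-dec (toℕ v ℕ.≟ 0))
  ¬loop : {u : Fin m} → ¬ Next u u
  ¬loop     (inj₁ e)       = ℕ.1+n≢n e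
  ¬loop {u} (inj₂ (e , z)) =
    contradiction (subst (3 ℕ.≤_) (trans (sym e) (cong suc z)) 3≤m) λ { (s≤s ()) }

subsets : ∀ m → List (Subset m)
subsets zero    = [] ∷ []
subsets (suc m) = map (inside ∷_) (subsets m) ++ map (outside ∷_) (subsets m)

minimum : List ℚᵘ → ℚᵘ
minimum []           = 0ℚᵘ
minimum (q ∷ [])     = q
minimum (q ∷ r ∷ rs) = q ℚ.⊓ minimum (r ∷ rs)

-- The list is nonempty exactly when k ≤ m, the only range in which i is used.
i : ∀ {m} → Graph m → (k : ℕ) → .{{NonZero k}} → ℚᵘ
i {m} G k = minimum
  (map (λ A → + boundary G A ℚ./ k) (filter (λ A → ∣ A ∣ ℕ.≟ k) (subsets m)))

-- Functions on [a , b] are represented by maps ℝ → ℝ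
-- of which only the restriction to [a , b] is relevant.

_∈[_,_] : ℝ → ℝ → ℝ → Set
t ∈[ a , b ] = a ≤ t × t ≤ b

ExtensionalOn ConvexOn AffineOn : (a b : ℝ) → (ℝ → ℝ) → Set
ExtensionalOn a b f = ∀ s t → s ∈[ a , b ] → t ∈[ a , b ] → s ≈ t → f s ≈ f t
ConvexOn a b f = ∀ s t θ → s ∈[ a , b ] → t ∈[ a , b ] → θ ∈[ 0ℝ , 1ℝ ] →
  f (θ * s + (1ℝ - θ) * t) ≤ θ * f s + (1ℝ - θ) * f t
AffineOn a b f = ∃[ c ] ∃[ d ] (∀ t → t ∈[ a , b ] → f t ≈ c * t + d)

logℕ : ℕ → ℝ
logℕ k = log (+ k ℚ./ 1)

record IsConvexBelow {m} (G : Graph m) (f : ℝ → ℝ) : Set where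
  field
    extensional : ExtensionalOn 0ℝ (logℕ m) f
    convex      : ConvexOn 0ℝ (logℕ m) f
    below       : ∀ k .{{_ : NonZero k}} → k ℕ.≤ m → f (logℕ k) ≤ fromℚ (i G k)

record IsConvexMinorant {m} (G : Graph m) (ψ : ℝ → ℝ) : Set where
  field
    isConvexBelow : IsConvexBelow G ψ
    largest       : ∀ φ → IsConvexBelow G φ →
                    ∀ t → t ∈[ 0ℝ , logℕ m ] → φ t ≤ ψ t

-- "ψ_G is not linear"; ψ_G is unique as a function on [0 , log m].
MinorantNotLinear : ∀ {m} → Graph m → Set
MinorantNotLinear {m} G =
  Σ[ ψ ∈ (ℝ → ℝ) ] (IsConvexMinorant G ψ × ¬ AffineOn 0ℝ (logℕ m) ψ)

{-# OPTIONS --safe #-}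

-- A subset A ⊆ V(G) with |A| = k gives the cylinder A × V^(n-1) in G^n, which has
-- the same ratio of boundary to size, so i_{k m^(n-1)}(G^n) ≤ i_k(G).  If i_a(G^n)
-- were c log(m^n / a) + C, the value at a = m^n would force C = 0, the value n d at
-- a = 1 would force c log m ≥ d (d the degree of G), and the cylinders would put
-- every point (log k , i_k(G)) above the line c (log m - t), which meets the first
-- and the last of these points.  Then ψ_G would be that line.
--
-- For the cycle, an affine ψ_G would put (log 2 , 1) above the chord from (0 , 2)
-- to (log m , 0), that is, log m ≤ log 4.
--
-- ψ_G itself is constructed as a maximum of finitely many lines; that it is the
-- largest convex function is an inequality of reals, so its proof may argue
-- classically, by gift wrapping.

module Submission where

open import Defs
open import Data.Nat.Base as ℕ using (ℕ; NonZero; zero; suc; z≤n; s≤s)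
open import Data.Nat.Properties using (m≤n+m; ≤-trans)
import Data.Nat.Properties as ℕ
open import Data.Integer.Base as ℤ using (+_)
import Data.Integer.Properties as ℤ
import Data.Rational.Unnormalised as ℚ
open ℚ using (ℚᵘ; mkℚᵘ; 0ℚᵘ; 1ℚᵘ; *≤*; *≡*)
import Data.Rational.Unnormalised.Properties as ℚ
open import Data.Rational.Unnormalised.Solver using (module +-*-Solver)
open import Data.Bool.Base using (true; false)
open import Data.Fin.Base as Fin
  using (Fin; zero; suc; toℕ; fromℕ<; inject₁; finToFun; funToFin; combine; quotient; remainder)
import Data.Fin.Properties as Fin
open import Data.Fin.Subset as Subset
  using (Subset; inside; outside; _∈_; _∉_; ∁; ∣_∣; ⁅_⁆; ⊤; ⊥)
import Data.Fin.Subset.Properties as Subset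
open import Data.List.Base as List
  using (List; []; _∷_; _++_; map; filter; length; allFin; cartesianProduct)
import Data.List.Properties as List
open import Data.List.Membership.Propositional using () renaming (_∈_ to _∈ˡ_)
open import Data.List.Membership.Propositional.Properties
  using (∈-∃++; ∈-++⁺ˡ; ∈-++⁺ʳ; ∈-++⁻; ∈-filter⁺; ∈-filter⁻; ∈-map⁺; ∈-allFin; ∈-cartesianProduct⁺)
open import Data.List.Relation.Unary.All as All using ([]; _∷_)
open import Data.List.Relation.Unary.AllPairs using ([]; _∷_)
open import Data.List.Relation.Unary.Any using (here; there)
open import Data.List.Relation.Unary.Unique.Propositional using (Unique)
import Data.List.Relation.Unary.Unique.Propositional.Properties as Unique
open import Data.Vec.Base as Vec using ([]; _∷_; here; there; lookup; replicate; concat)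
import Data.Vec.Properties as Vec
open import Data.Vec.Functional using (updateAt)
open import Data.Vec.Functional.Properties using (updateAt-updates; updateAt-minimal)
open import Data.Product using (_×_; ∃-syntax; Σ-syntax; _,_; proj₁; proj₂)
open import Data.Sum using (_⊎_; inj₁; inj₂)
open import Function.Base using (_∘_; const; it)
open import Relation.Nullary using (¬_; yes; no; does; contradiction)
open import Relation.Nullary.Decidable using (_×-dec_)
open import Relation.Unary using (Decidable)
open import Relation.Binary using (tri<; tri≈; tri>)
open import Relation.Binary.Construct.Closure.ReflexiveTransitive
  using (Star; _◅_; _◅◅_; reverse)
open import Relation.Binary.PropositionalEquality
  using (_≡_; _≢_; refl; sym; trans; cong; cong₂; subst; subst₂)
open +-*-Solver using (solve; _:+_; _:*_; _:-_; :-_; _:=_; con)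
open CauchyProofs
open LogProofs using (nat; inv; nat*inv; block-lower)

-- Real numbers

-- No isoperimetric inequality for powers is proved. A lower bound on `i` beyond nonnegativity is
-- used only at single vertices, where it is a degree count; cylinders, the whole vertex set among
-- them, supply upper bounds only. What shapes the proof is the arithmetic of the reals. Their order
-- is undecidable, so the extreme points of a finite set cannot be selected to define a hull; a
-- maximum over all chord slopes needs no selection. Strict inequality has to come as data, a
-- rational bound that eventually holds, because reciprocals are computed from it; for logarithms
-- `log b - log a ≥ 1/b` when `a < b` provides it. Most real inequalities are proved by
-- certificates: the difference of the two sides is written as a sum of terms that are nonnegative,
-- or null up to `_≈_`, and the ring solver checks the identity term by term.

Eventually : (ℕ → Set) → Set
Eventually P = ∃[ N ] (∀ n → N ℕ.≤ n → P n)

always : ∀ {P} → (∀ n → P n) → Eventually P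
always p = 0 , λ n _ → p n

both : ∀ {P Q R} → (∀ n → P n → Q n → R n) → Eventually P → Eventually Q → Eventually R
both f (N , p) (M , q) = N ℕ.+ M , λ n h →
  f n (p n (ℕ.m+n≤o⇒m≤o N h)) (q n (ℕ.m+n≤o⇒n≤o N h))

eventually-map : ∀ {P Q} → (∀ n → P n → Q n) → Eventually P → Eventually Q
eventually-map f (N , p) = N , λ n h → f n (p n h)

witness : ∀ {P} → Eventually P → ∃[ n ] P n
witness (N , p) = N , p N ℕ.≤-refl

p≤∣p∣ : ∀ p → p ℚ.≤ ℚ.∣ p ∣
p≤∣p∣ p@(mkℚᵘ (+ _) _)       = ℚ.≤-refl
p≤∣p∣   (mkℚᵘ ℤ.-[1+ _ ] _) = *≤* ℤ.-≤+

∣p-q∣≤r⇒p≤q+r : ∀ p q {r} → ℚ.∣ p ℚ.- q ∣ ℚ.≤ r → p ℚ.≤ q ℚ.+ r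
∣p-q∣≤r⇒p≤q+r p q {r} h = ℚ.≤-trans
  (ℚ.≤-reflexive (solve 2 (λ p q → p := q :+ (p :- q)) ℚ.≃-refl p q))
  (ℚ.+-monoʳ-≤ q (ℚ.≤-trans (p≤∣p∣ (p ℚ.- q)) h))

∣p-q∣≤r⇒q≤p+r : ∀ p q {r} → ℚ.∣ p ℚ.- q ∣ ℚ.≤ r → q ℚ.≤ p ℚ.+ r
∣p-q∣≤r⇒q≤p+r p q h = ∣p-q∣≤r⇒p≤q+r q p (∣∣-sym p q h)

p≤q+r⇒p-q≤r : ∀ p q {r} → p ℚ.≤ q ℚ.+ r → p ℚ.- q ℚ.≤ r
p≤q+r⇒p-q≤r p q {r} h = ℚ.≤-trans (ℚ.+-monoˡ-≤ (ℚ.- q) h)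
  (ℚ.≤-reflexive (solve 2 (λ q r → (q :+ r) :- q := r) ℚ.≃-refl q r))

∣p-q∣≤r : ∀ p q {r} → p ℚ.≤ q ℚ.+ r → q ℚ.≤ p ℚ.+ r → ℚ.∣ p ℚ.- q ∣ ℚ.≤ r
∣p-q∣≤r p q h h′ with ℚ.∣p∣≡p∨∣p∣≡-p (p ℚ.- q)
... | inj₁ e rewrite e = p≤q+r⇒p-q≤r p q h
... | inj₂ e rewrite e = ℚ.≤-trans
  (ℚ.≤-reflexive (solve 2 (λ p q → :- (p :- q) := q :- p) ℚ.≃-refl p q))
  (p≤q+r⇒p-q≤r q p h′)

p≤p+ε : ∀ p {ε} → 0ℚᵘ ℚ.< ε → p ℚ.≤ p ℚ.+ ε
p≤p+ε p {ε} ε>0 = ℚ.p≤p+q p ε {{ℚ.nonNegative (ℚ.<⇒≤ ε>0)}}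

0≤*ℚ : ∀ p q → 0ℚᵘ ℚ.≤ p → 0ℚᵘ ℚ.≤ q → 0ℚᵘ ℚ.≤ p ℚ.* q
0≤*ℚ p q h h′ = ℚ.nonNegative⁻¹ (p ℚ.* q)
  {{ℚ.nonNeg*nonNeg⇒nonNeg p {{ℚ.nonNegative h}} q {{ℚ.nonNegative h′}}}}

0≤+ℚ : ∀ p q → 0ℚᵘ ℚ.≤ p → 0ℚᵘ ℚ.≤ q → 0ℚᵘ ℚ.≤ p ℚ.+ q
0≤+ℚ p q h h′ = ℚ.+-mono-≤ {0ℚᵘ} {p} {0ℚᵘ} {q} h h′

≈⇒≤ : ∀ {x y} → x ≈ y → x ≤ y
≈⇒≤ {x} {y} (mk≈ h) = mk≤ λ ε ε>0 →
  eventually-map (λ n → ∣p-q∣≤r⇒p≤q+r (seq x n) (seq y n)) (h ε ε>0)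

≤ᴿ-antisym : ∀ {x y} → x ≤ y → y ≤ x → x ≈ y
≤ᴿ-antisym {x} {y} (mk≤ h) (mk≤ k) = mk≈ λ ε ε>0 →
  both (λ n → ∣p-q∣≤r (seq x n) (seq y n)) (h ε ε>0) (k ε ε>0)

≤ᴿ-eventually : ∀ {x y} → Eventually (λ n → seq x n ℚ.≤ seq y n) → x ≤ y
≤ᴿ-eventually {x} {y} h = mk≤ λ ε ε>0 →
  eventually-map (λ n p → ℚ.≤-trans p (p≤p+ε (seq y n) ε>0)) h

≈-pointwise : ∀ {x y} → (∀ n → seq x n ℚ.≃ seq y n) → x ≈ y
≈-pointwise e = ≤ᴿ-antisym (≤ᴿ-eventually (always λ n → ℚ.≤-reflexive (e n)))
  (≤ᴿ-eventually (always λ n → ℚ.≤-reflexive (ℚ.≃-sym (e n))))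

≤ᴿ-refl : ∀ {x} → x ≤ x
≤ᴿ-refl = ≤ᴿ-eventually (always λ _ → ℚ.≤-refl)

≤ᴿ-trans : ∀ {x y z} → x ≤ y → y ≤ z → x ≤ z
≤ᴿ-trans {x} {y} {z} (mk≤ h) (mk≤ k) = mk≤ λ ε ε>0 →
  both (λ n p q → ℚ.≤-trans p (ℚ.≤-trans (ℚ.+-monoˡ-≤ (half ε) q)
      (ℚ.≤-reflexive (ℚ.≃-trans (ℚ.+-assoc (seq z n) (half ε) (half ε))
        (ℚ.+-congʳ (seq z n) (half+half ε))))))
    (h (half ε) (half-pos ε ε>0)) (k (half ε) (half-pos ε ε>0))

≈-refl : ∀ {x} → x ≈ x
≈-refl = ≈-pointwise λ _ → ℚ.≃-refl

≈-sym : ∀ {x y} → x ≈ y → y ≈ x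
≈-sym {x} {y} (mk≈ h) = mk≈ λ ε ε>0 →
  eventually-map (λ n → ∣∣-sym (seq x n) (seq y n)) (h ε ε>0)

≈-trans : ∀ {x y z} → x ≈ y → y ≈ z → x ≈ z
≈-trans p q = ≤ᴿ-antisym (≤ᴿ-trans (≈⇒≤ p) (≈⇒≤ q))
  (≤ᴿ-trans (≈⇒≤ (≈-sym q)) (≈⇒≤ (≈-sym p)))

≤ᴿ-respˡ : ∀ {x x′ y} → x ≈ x′ → x ≤ y → x′ ≤ y
≤ᴿ-respˡ e = ≤ᴿ-trans (≈⇒≤ (≈-sym e))

≤ᴿ-respʳ : ∀ {x y y′} → y ≈ y′ → x ≤ y → x ≤ y′
≤ᴿ-respʳ e h = ≤ᴿ-trans h (≈⇒≤ e)

+-mono : ∀ {x y z w} → x ≤ y → z ≤ w → x + z ≤ y + w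
+-mono {x} {y} {z} {w} (mk≤ h) (mk≤ k) = mk≤ λ ε ε>0 →
  both (λ n p q → ℚ.≤-trans (ℚ.+-mono-≤ p q)
      (ℚ.≤-reflexive (ℚ.≃-trans
        (solve 3 (λ y w e → (y :+ e) :+ (w :+ e) := (y :+ w) :+ (e :+ e)) ℚ.≃-refl
          (seq y n) (seq w n) (half ε))
        (ℚ.+-congʳ (seq y n ℚ.+ seq w n) (half+half ε)))))
    (h (half ε) (half-pos ε ε>0)) (k (half ε) (half-pos ε ε>0))

+ᴿ-cong : ∀ {x y z w} → x ≈ y → z ≈ w → x + z ≈ y + w
+ᴿ-cong p q = ≤ᴿ-antisym (+-mono (≈⇒≤ p) (≈⇒≤ q))
  (+-mono (≈⇒≤ (≈-sym p)) (≈⇒≤ (≈-sym q)))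

0≤y-x : ∀ {x y} → x ≤ y → 0ℝ ≤ y - x
0≤y-x {x} {y} h = ≤ᴿ-respˡ {x + (0ℝ - x)} {0ℝ} {y - x}
  (≈-pointwise λ n → solve 1 (λ x → x :+ (con 0ℚᵘ :- x) := con 0ℚᵘ) ℚ.≃-refl (seq x n))
  (≤ᴿ-respʳ {y = y + (0ℝ - x)}
    (≈-pointwise λ n → solve 2 (λ x y → y :+ (con 0ℚᵘ :- x) := y :- x) ℚ.≃-refl (seq x n) (seq y n))
    (+-mono h (≤ᴿ-refl {0ℝ - x})))

-- The form in which certificates are given: `e` collects products of nonnegative reals. Facts that
-- hold only up to `_≈_`, such as `u * r ≈ 1ℝ`, enter `e` as summands that are null by `null-*`.
≤-via : ∀ {x y} e → 0ℝ ≤ e → (∀ n → seq x n ℚ.+ seq e n ℚ.≃ seq y n) → x ≤ y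
≤-via {x} {y} e h p = ≤ᴿ-respˡ {x + 0ℝ} {x} (≈-pointwise λ n → ℚ.+-identityʳ (seq x n))
  (≤ᴿ-respʳ {y = x + e} (≈-pointwise p) (+-mono (≤ᴿ-refl {x}) h))

0≤+ : ∀ {x y} → 0ℝ ≤ x → 0ℝ ≤ y → 0ℝ ≤ x + y
0≤+ {x} {y} h k = ≤ᴿ-respˡ {0ℝ + 0ℝ} {0ℝ} {x + y} (≈-pointwise λ _ → ℚ.≃-refl) (+-mono h k)

eventually-bounded : ∀ x → Bounded (seq x)
eventually-bounded x = bounded (seq x) (cauchy x 1ℚᵘ (ℚ.positive⁻¹ 1ℚᵘ))

-- Nonnegative limits may have slightly negative terms, so the product has to absorb an error. The
-- sign of the rational `p` is decidable, and for either sign the right-hand side regroups into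
-- products of nonnegative factors.
0≤*-approx : ∀ p q B C δ → 0ℚᵘ ℚ.≤ B → 0ℚᵘ ℚ.≤ C → 0ℚᵘ ℚ.≤ δ →
  p ℚ.≤ B → q ℚ.≤ C → 0ℚᵘ ℚ.≤ p ℚ.+ δ → 0ℚᵘ ℚ.≤ q ℚ.+ δ →
  0ℚᵘ ℚ.≤ p ℚ.* q ℚ.+ (B ℚ.* δ ℚ.+ C ℚ.* δ)
0≤*-approx p q B C δ B≥0 C≥0 δ≥0 p≤B q≤C p≥ q≥ with ℚ.≤-total 0ℚᵘ p
... | inj₁ p≥0 = ℚ.≤-respʳ-≃
  (solve 5 (λ p q B C δ → (p :* (q :+ δ) :+ (B :- p) :* δ) :+ C :* δ
      := p :* q :+ (B :* δ :+ C :* δ)) ℚ.≃-refl p q B C δ)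
  (0≤+ℚ _ _ (0≤+ℚ _ _ (0≤*ℚ p _ p≥0 q≥) (0≤*ℚ _ δ (ℚ.p≤q⇒0≤q-p p≤B) δ≥0)) (0≤*ℚ C δ C≥0 δ≥0))
... | inj₂ p≤0 = ℚ.≤-respʳ-≃
  (solve 5 (λ p q B C δ → ((con 0ℚᵘ :- p) :* (C :- q) :+ C :* (p :+ δ)) :+ B :* δ
      := p :* q :+ (B :* δ :+ C :* δ)) ℚ.≃-refl p q B C δ)
  (0≤+ℚ _ _ (0≤+ℚ _ _ (0≤*ℚ _ _ (ℚ.p≤q⇒0≤q-p p≤0) (ℚ.p≤q⇒0≤q-p q≤C)) (0≤*ℚ C _ C≥0 p≥))
    (0≤*ℚ B δ B≥0 δ≥0))

0≤* : ∀ {x y} → 0ℝ ≤ x → 0ℝ ≤ y → 0ℝ ≤ x * y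
0≤* {x} {y} (mk≤ h) (mk≤ k) = mk≤ go
  where
  go : ∀ ε → 0ℚᵘ ℚ.< ε → Eventually λ n → 0ℚᵘ ℚ.≤ seq x n ℚ.* seq y n ℚ.+ ε
  go ε ε>0 =
    let (N , B , B>0 , hB) = eventually-bounded x
        (M , C , C>0 , hC) = eventually-bounded y
        (δ , δ>0 , e)      = share B C ε B>0 C>0 ε>0
    in both (λ n (p≤B , q≤C) (p≥ , q≥) → ℚ.≤-respʳ-≃ (ℚ.+-congʳ (seq x n ℚ.* seq y n) e)
          (0≤*-approx (seq x n) (seq y n) B C δ (ℚ.<⇒≤ B>0) (ℚ.<⇒≤ C>0) (ℚ.<⇒≤ δ>0)
            (ℚ.≤-trans (p≤∣p∣ _) p≤B) (ℚ.≤-trans (p≤∣p∣ _) q≤C) p≥ q≥))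
        (both (λ _ → _,_) (N , hB) (M , hC)) (both (λ _ → _,_) (h δ δ>0) (k δ δ>0))

null-* : ∀ {x y} → x ≈ 0ℝ → x * y ≈ 0ℝ
null-* {x} {y} (mk≈ h) = mk≈ go
  where
  go : ∀ ε → 0ℚᵘ ℚ.< ε → Eventually λ n → ℚ.∣ seq x n ℚ.* seq y n ℚ.- 0ℚᵘ ∣ ℚ.≤ ε
  go ε ε>0 =
    let (N , B , B>0 , hB) = eventually-bounded y
        (δ , δ>0 , e)      = share B B ε B>0 B>0 ε>0
        Bδ≤ε : B ℚ.* δ ℚ.≤ ε
        Bδ≤ε = ℚ.≤-trans (ℚ.p≤p+q (B ℚ.* δ) (B ℚ.* δ)
            {{ℚ.nonNegative (0≤*ℚ B δ (ℚ.<⇒≤ B>0) (ℚ.<⇒≤ δ>0))}}) (ℚ.≤-reflexive e)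
    in both (λ n p q → ∣∣-resp _ (seq y n ℚ.* (seq x n ℚ.- 0ℚᵘ))
          (solve 2 (λ x y → x :* y :- con 0ℚᵘ := y :* (x :- con 0ℚᵘ)) ℚ.≃-refl (seq x n) (seq y n))
          (ℚ.≤-trans (abs-*-mono (seq y n) (seq x n ℚ.- 0ℚᵘ) B δ p q) Bδ≤ε))
        (N , hB) (h δ δ>0)

x-y≈0 : ∀ {x y} → x ≈ y → x - y ≈ 0ℝ
x-y≈0 {x} {y} (mk≈ h) = mk≈ λ ε ε>0 →
  eventually-map (λ n → ∣∣-resp _ (seq x n ℚ.- seq y n) (ℚ.+-identityʳ _)) (h ε ε>0)

≈-via : ∀ {x y} e → e ≈ 0ℝ → (∀ n → seq x n ℚ.+ seq e n ℚ.≃ seq y n) → x ≈ y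
≈-via {x} {y} e h p = ≈-trans {x} {x + 0ℝ} {y} (≈-pointwise λ n → ℚ.≃-sym (ℚ.+-identityʳ (seq x n)))
  (≈-trans {y = x + e} (+ᴿ-cong (≈-refl {x}) (≈-sym h)) (≈-pointwise p))

*ᴿ-congʳ : ∀ {x y} z → x ≈ y → x * z ≈ y * z
*ᴿ-congʳ {x} {y} z h = ≈-via ((y - x) * z) (null-* (x-y≈0 (≈-sym h)))
  λ n → solve 3 (λ x y z → x :* z :+ (y :- x) :* z := y :* z) ℚ.≃-refl (seq x n) (seq y n) (seq z n)

*ᴿ-comm : ∀ x y → x * y ≈ y * x
*ᴿ-comm x y = ≈-pointwise λ n → ℚ.*-comm (seq x n) (seq y n)

*ᴿ-congˡ : ∀ {x y} z → x ≈ y → z * x ≈ z * y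
*ᴿ-congˡ {x} {y} z h = ≈-trans (*ᴿ-comm z x) (≈-trans (*ᴿ-congʳ z h) (*ᴿ-comm y z))

-- Kept as data rather than as `¬ x ≤ 0ℝ`, since `Reciprocal` computes with the bound `δ`.
record Positive (x : ℝ) : Set where
  constructor mkPositive
  field
    δ     : ℚᵘ
    δ>0   : 0ℚᵘ ℚ.< δ
    above : Eventually λ n → δ ℚ.≤ seq x n

open Positive

positive⇒≰0 : ∀ {x} → Positive x → ¬ x ≤ 0ℝ
positive⇒≰0 {x} (mkPositive δ δ>0 h) (mk≤ k) =
  let (_ , δ≤x , x≤) = witness (both (λ _ → _,_) h (k (half δ) (half-pos δ δ>0)))
  in ℚ.<⇒≱ (half<δ) (ℚ.≤-trans δ≤x (ℚ.≤-respʳ-≃ (ℚ.+-identityˡ (half δ)) x≤))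
  where
  half<δ : half δ ℚ.< δ
  half<δ = ℚ.<-respʳ-≃ (half+half δ) (ℚ.<-respˡ-≃ (ℚ.+-identityʳ (half δ))
    (ℚ.+-monoʳ-< (half δ) (half-pos δ δ>0)))

positive⇒0≤ : ∀ {x} → Positive x → 0ℝ ≤ x
positive⇒0≤ (mkPositive δ δ>0 h) = ≤ᴿ-eventually
  (eventually-map (λ _ → ℚ.≤-trans (ℚ.<⇒≤ δ>0)) h)

-- A decidable substitute for comparison with 0: beyond some index the terms vary by at most `ε/4`,
-- so comparing a single term with `ε/2` settles one of two overlapping alternatives.
small⊎positive : ∀ x ε → 0ℚᵘ ℚ.< ε → Eventually (λ n → seq x n ℚ.≤ 0ℚᵘ ℚ.+ ε) ⊎ Positive x
small⊎positive x ε ε>0 with cauchy x (half (half ε)) (half-pos _ (half-pos ε ε>0))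
... | N , h with seq x N ℚ.≤? half ε
... | yes p = inj₁ (N , λ n N≤n → ℚ.≤-trans (∣p-q∣≤r⇒p≤q+r (seq x n) (seq x N) (h n N N≤n ℕ.≤-refl))
        (ℚ.≤-trans (ℚ.+-mono-≤ p q≤h)
          (ℚ.≤-reflexive (ℚ.≃-trans (half+half ε) (ℚ.≃-sym (ℚ.+-identityˡ ε))))))
  where
  q≤h : half (half ε) ℚ.≤ half ε
  q≤h = ℚ.≤-trans (p≤p+ε (half (half ε)) (half-pos _ (half-pos ε ε>0)))
    (ℚ.≤-reflexive (half+half (half ε)))
... | no p = inj₂ (mkPositive (half (half ε)) (half-pos _ (half-pos ε ε>0))
        (N , λ n N≤n → ℚ.≤-trans
          (ℚ.≤-reflexive (ℚ.≃-trans
            (solve 1 (λ q → q := (q :+ q) :- q) ℚ.≃-refl (half (half ε)))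
            (ℚ.+-congˡ (ℚ.- half (half ε)) (half+half (half ε)))))
          (p≤q+r⇒p-q≤r _ _ (ℚ.≤-trans (ℚ.<⇒≤ (ℚ.≰⇒> p))
            (ℚ.≤-respʳ-≃ (ℚ.+-comm (seq x n) _)
              (∣p-q∣≤r⇒q≤p+r (seq x n) (seq x N) (h n N N≤n ℕ.≤-refl)))))))

¬positive⇒≤0 : ∀ {x} → ¬ Positive x → x ≤ 0ℝ
¬positive⇒≤0 {x} ¬p = mk≤ λ ε ε>0 → go ε (small⊎positive x ε ε>0)
  where
  go : ∀ ε → Eventually (λ n → seq x n ℚ.≤ 0ℚᵘ ℚ.+ ε) ⊎ Positive x →
       Eventually λ n → seq x n ℚ.≤ 0ℚᵘ ℚ.+ ε
  go ε (inj₁ h) = h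
  go ε (inj₂ p) = contradiction p ¬p

x-y≤0⇒x≤y : ∀ {x y} → x - y ≤ 0ℝ → x ≤ y
x-y≤0⇒x≤y {x} {y} h = ≤-via (0ℝ - (x - y)) (0≤y-x h)
  λ n → solve 2 (λ x y → x :+ (con 0ℚᵘ :- (x :- y)) := y) ℚ.≃-refl (seq x n) (seq y n)

x≤y⇒x-y≤0 : ∀ {x y} → x ≤ y → x - y ≤ 0ℝ
x≤y⇒x-y≤0 {x} {y} h = ≤-via (y - x) (0≤y-x h)
  λ n → solve 2 (λ x y → (x :- y) :+ (y :- x) := con 0ℚᵘ) ℚ.≃-refl (seq x n) (seq y n)

-- By `¬positive⇒≤0`, an inequality amounts to the negation of `Positive (x - y)`, and negations are
-- stable. This licenses the classical arguments about hulls.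
≤-stable : ∀ {x y} → ¬ ¬ x ≤ y → x ≤ y
≤-stable ¬¬h = x-y≤0⇒x≤y (¬positive⇒≤0 λ p → ¬¬h λ h → positive⇒≰0 p (x≤y⇒x-y≤0 h))

≰⇒≥ : ∀ {x y} → ¬ x ≤ y → y ≤ x
≰⇒≥ {x} {y} ¬h = ≤-stable λ ¬k → ¬h (x-y≤0⇒x≤y (¬positive⇒≤0 λ p →
  ¬k (≤-via (x - y) (positive⇒0≤ p)
    λ n → solve 2 (λ x y → y :+ (x :- y) := x) ℚ.≃-refl (seq x n) (seq y n))))

-- The order of two reals is undecidable, but a case split on it is harmless
-- when the goal is an inequality, which is ¬¬-stable.
≤-cases : ∀ {A : Set} x y → (x ≤ y → ¬ ¬ A) → (y ≤ x → ¬ ¬ A) → ¬ ¬ A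
≤-cases x y f g ¬a = (λ ¬h → g (≰⇒≥ ¬h) ¬a) λ h → f h ¬a

-- Maxima and minimisers of finitely many reals

abstract
  ⊔-cauchy : ∀ s t → IsCauchy s → IsCauchy t → IsCauchy (λ n → s n ℚ.⊔ t n)
  ⊔-cauchy s t cs ct ε ε>0 with cs ε ε>0 | ct ε ε>0
  ... | N , h | M , k = N ℕ.+ M , λ m n hm hn →
    let ds = h m n (ℕ.m+n≤o⇒m≤o N hm) (ℕ.m+n≤o⇒m≤o N hn)
        dt = k m n (ℕ.m+n≤o⇒n≤o N hm) (ℕ.m+n≤o⇒n≤o N hn)
    in ∣p-q∣≤r (s m ℚ.⊔ t m) (s n ℚ.⊔ t n)
      (upper (s m) (t m) (s n) (t n)
        (∣p-q∣≤r⇒p≤q+r (s m) (s n) ds) (∣p-q∣≤r⇒p≤q+r (t m) (t n) dt))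
      (upper (s n) (t n) (s m) (t m)
        (∣p-q∣≤r⇒q≤p+r (s m) (s n) ds) (∣p-q∣≤r⇒q≤p+r (t m) (t n) dt))
    where
    upper : ∀ p q r s → p ℚ.≤ r ℚ.+ ε → q ℚ.≤ s ℚ.+ ε → p ℚ.⊔ q ℚ.≤ (r ℚ.⊔ s) ℚ.+ ε
    upper p q r s h k = ℚ.⊔-lub {(r ℚ.⊔ s) ℚ.+ ε} {p} {q}
      (ℚ.≤-trans h (ℚ.+-monoˡ-≤ ε (ℚ.p≤p⊔q r s)))
      (ℚ.≤-trans k (ℚ.+-monoˡ-≤ ε (ℚ.p≤q⊔p r s)))

infixl 6 _⊔ᴿ_

abstract
  _⊔ᴿ_ : ℝ → ℝ → ℝ
  x ⊔ᴿ y = mkℝ (λ n → seq x n ℚ.⊔ seq y n)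
    (⊔-cauchy (seq x) (seq y) (cauchy x) (cauchy y))

  x≤x⊔y : ∀ x y → x ≤ x ⊔ᴿ y
  x≤x⊔y x y = ≤ᴿ-eventually (always λ n → ℚ.p≤p⊔q (seq x n) (seq y n))

  y≤x⊔y : ∀ x y → y ≤ x ⊔ᴿ y
  y≤x⊔y x y = ≤ᴿ-eventually (always λ n → ℚ.p≤q⊔p (seq x n) (seq y n))

  ⊔ᴿ-lub : ∀ {x y z} → x ≤ z → y ≤ z → x ⊔ᴿ y ≤ z
  ⊔ᴿ-lub {x} {y} {z} (mk≤ h) (mk≤ k) = mk≤ λ ε ε>0 →
    both (λ n → ℚ.⊔-lub {seq z n ℚ.+ ε} {seq x n} {seq y n}) (h ε ε>0) (k ε ε>0)

⨆ : ℕ → (ℕ → ℝ) → ℝ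
⨆ zero    f = f 0
⨆ (suc n) f = ⨆ n f ⊔ᴿ f (suc n)

⨆-upper : ∀ n f k → k ℕ.≤ n → f k ≤ ⨆ n f
⨆-upper zero    f zero    _ = ≤ᴿ-refl
⨆-upper (suc n) f k       h with k ℕ.≟ suc n
... | yes refl = y≤x⊔y (⨆ n f) (f (suc n))
... | no  k≢   = ≤ᴿ-trans (⨆-upper n f k (ℕ.≤-pred (ℕ.≤∧≢⇒< h k≢))) (x≤x⊔y (⨆ n f) (f (suc n)))

⨆-lub : ∀ n f {z} → (∀ k → k ℕ.≤ n → f k ≤ z) → ⨆ n f ≤ z
⨆-lub zero    f h = h 0 z≤n
⨆-lub (suc n) f h =
  ⊔ᴿ-lub (⨆-lub n f λ k k≤n → h k (ℕ.m≤n⇒m≤1+n k≤n)) (h (suc n) ℕ.≤-refl)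

-- Naming a minimiser would decide the order of reals, hence the double negation.
¬¬argmin : ∀ n (f : ℕ → ℝ) → ¬ ¬ (∃[ k ] (k ℕ.≤ n × (∀ l → l ℕ.≤ n → f k ≤ f l)))
¬¬argmin zero    f ¬p = ¬p (0 , z≤n , λ { zero _ → ≤ᴿ-refl })
¬¬argmin (suc n) f ¬p = ¬¬argmin n f λ (k , k≤n , min) →
  ≤-cases (f k) (f (suc n))
    (λ h ¬q → ¬q (k , ℕ.m≤n⇒m≤1+n k≤n , extend n k min h))
    (λ h ¬q → ¬q (suc n , ℕ.≤-refl ,
      extend n (suc n) (λ l l≤n → ≤ᴿ-trans h (min l l≤n)) ≤ᴿ-refl)) ¬p
  where
  extend : ∀ n k → (∀ l → l ℕ.≤ n → f k ≤ f l) → f k ≤ f (suc n) →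
           ∀ l → l ℕ.≤ suc n → f k ≤ f l
  extend n k min h l l≤ with l ℕ.≟ suc n
  ... | yes refl = h
  ... | no  l≢   = min l (ℕ.≤-pred (ℕ.≤∧≢⇒< l≤ l≢))

-- Clipping x at its lower bound δ makes every term of the sequence invertible
-- without changing the limit.
module Reciprocal (x : ℝ) (x>0 : Positive x) where

  clip : ℕ → ℚᵘ
  clip n = seq x n ℚ.⊔ δ x>0

  clip-pos : ∀ n → ℚ.Positive (clip n)
  clip-pos n = ℚ.positive (ℚ.<-≤-trans (δ>0 x>0) (ℚ.p≤q⊔p (seq x n) (δ x>0)))

  rec : ℕ → ℚᵘ
  rec n = ℚ.1/_ (clip n) {{ℚ.pos⇒nonZero (clip n) {{clip-pos n}}}}

  rec-pos : ∀ n → ℚ.Positive (rec n)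
  rec-pos n = ℚ.1/pos⇒pos (clip n) {{clip-pos n}}

  clip*rec : ∀ n → clip n ℚ.* rec n ℚ.≃ 1ℚᵘ
  clip*rec n = ℚ.*-inverseʳ (clip n) {{ℚ.pos⇒nonZero (clip n) {{clip-pos n}}}}

  R : ℚᵘ
  R = ℚ.1/_ (δ x>0) {{ℚ.pos⇒nonZero (δ x>0) {{ℚ.positive (δ>0 x>0)}}}}

  R-pos : ℚ.Positive R
  R-pos = ℚ.1/pos⇒pos (δ x>0) {{ℚ.positive (δ>0 x>0)}}

  ∣rec∣≤R : ∀ n → ℚ.∣ rec n ∣ ℚ.≤ R
  ∣rec∣≤R n = ℚ.≤-trans
    (ℚ.≤-reflexive (ℚ.0≤p⇒∣p∣≃p (ℚ.<⇒≤ (ℚ.positive⁻¹ (rec n) {{rec-pos n}}))))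
    (ℚ.1/-antimono-≤-pos {{ℚ.positive (δ>0 x>0)}} {{clip-pos n}} (ℚ.p≤q⊔p (seq x n) (δ x>0)))

  rec-minus : ∀ p q r s → p ℚ.* r ℚ.≃ 1ℚᵘ → q ℚ.* s ℚ.≃ 1ℚᵘ →
              r ℚ.- s ℚ.≃ r ℚ.* (s ℚ.* (q ℚ.- p))
  rec-minus p q r s pr qs = ℚ.≃-sym (ℚ.≃-trans
    (solve 4 (λ p q r s → r :* (s :* (q :- p)) := r :* (q :* s) :- s :* (p :* r)) ℚ.≃-refl p q r s)
    (ℚ.+-cong (ℚ.≃-trans (ℚ.*-congˡ {r} qs) (ℚ.*-identityʳ r))
      (ℚ.-‿cong (ℚ.≃-trans (ℚ.*-congˡ {s} pr) (ℚ.*-identityʳ s)))))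

  rec-cauchy : IsCauchy rec
  rec-cauchy ε ε>0 =
    let S>0 = ℚ.positive⁻¹ (R ℚ.* R) {{ℚ.pos*pos⇒pos R {{R-pos}} R {{R-pos}}}}
        (η , η>0 , e) = share (R ℚ.* R) (R ℚ.* R) ε S>0 S>0 ε>0
        (N , h) = ⊔-cauchy (seq x) (λ _ → δ x>0) (cauchy x) (const-cauchy (δ x>0)) η η>0
    in N , λ m n hm hn → ∣∣-resp (rec m ℚ.- rec n) (rec m ℚ.* (rec n ℚ.* (clip n ℚ.- clip m)))
      (rec-minus (clip m) (clip n) (rec m) (rec n) (clip*rec m) (clip*rec n))
      (ℚ.≤-trans
        (abs-*-mono (rec m) (rec n ℚ.* (clip n ℚ.- clip m)) R (R ℚ.* η) (∣rec∣≤R m)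
          (abs-*-mono (rec n) (clip n ℚ.- clip m) R η (∣rec∣≤R n) (h n m hn hm)))
        (ℚ.≤-trans (ℚ.≤-reflexive (ℚ.≃-sym (ℚ.*-assoc R R η)))
          (ℚ.≤-trans (ℚ.p≤p+q (R ℚ.* R ℚ.* η) (R ℚ.* R ℚ.* η)
              {{ℚ.nonNegative (0≤*ℚ (R ℚ.* R) η (ℚ.<⇒≤ S>0) (ℚ.<⇒≤ η>0))}})
            (ℚ.≤-reflexive e))))

  reciprocal : ℝ
  reciprocal = mkℝ rec rec-cauchy

  0≤reciprocal : 0ℝ ≤ reciprocal
  0≤reciprocal = ≤ᴿ-eventually (always λ n → ℚ.<⇒≤ (ℚ.positive⁻¹ (rec n) {{rec-pos n}}))

  x*reciprocal≈1 : x * reciprocal ≈ 1ℝ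
  x*reciprocal≈1 = mk≈ λ ε ε>0 → eventually-map (λ n δ≤x →
    ∣∣-resp _ 0ℚᵘ
      (ℚ.≃-trans (ℚ.+-congˡ (ℚ.- 1ℚᵘ)
          (ℚ.≃-trans (ℚ.*-congʳ {rec n} (ℚ.≃-sym (ℚ.p≥q⇒p⊔q≃p {seq x n} {δ x>0} δ≤x))) (clip*rec n)))
        (ℚ.+-inverseʳ 1ℚᵘ))
      (ℚ.<⇒≤ ε>0)) (above x>0)

HasReciprocal : ℝ → Set
HasReciprocal u = ∃[ r ] (0ℝ ≤ r × u * r ≈ 1ℝ)

abstract
  recip : ∀ {u} → Positive u → HasReciprocal u
  recip {u} u>0 = reciprocal , 0≤reciprocal , x*reciprocal≈1
    where open Reciprocal u u>0

*-cancel-≤ : ∀ {u z w} → HasReciprocal u → z * u ≤ w * u → z ≤ w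
*-cancel-≤ {u} {z} {w} (r , r≥0 , ur≈1) h =
  ≤-via ((w * u - z * u) * r + (1ℝ - u * r) * (w - z))
    (0≤+ (0≤* (0≤y-x h) r≥0) (≈⇒≤ (≈-sym (null-* (x-y≈0 (≈-sym ur≈1))))))
    λ n → solve 4 (λ u r z w → z :+ ((w :* u :- z :* u) :* r :+ (con 1ℚᵘ :- u :* r) :* (w :- z)) := w)
      ℚ.≃-refl (seq u n) (seq r n) (seq z n) (seq w n)

-- Here `r` stands for `1 / (q - p)` and the weight is `(q - t) / (q - p)`. The mixture of `p` and
-- `q` is `t` only up to `_≈_`, so extensionality of `f` is called upon.
convex-chord : ∀ {a b} f → ExtensionalOn a b f → ConvexOn a b f →
  ∀ {p q t r} → p ∈[ a , b ] → q ∈[ a , b ] → p ≤ t → t ≤ q → 0ℝ ≤ r → (q - p) * r ≈ 1ℝ →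
  f t ≤ ((q - t) * r) * f p + ((t - p) * r) * f q
convex-chord {a} {b} f ext conv {p} {q} {t} {r} p∈ q∈ p≤t t≤q r≥0 e =
  ≤ᴿ-respʳ (+ᴿ-cong (≈-refl {θ * f p}) (*ᴿ-congʳ (f q) 1-θ≈))
    (≤ᴿ-respˡ (ext _ t (≤ᴿ-respʳ (≈-sym mix≈t) (proj₁ t∈) , ≤ᴿ-respˡ (≈-sym mix≈t) (proj₂ t∈)) t∈ mix≈t)
      (conv p q θ p∈ q∈ (0≤* (0≤y-x t≤q) r≥0 , θ≤1)))
  where
  θ = (q - t) * r
  null : 1ℝ - (q - p) * r ≈ 0ℝ
  null = x-y≈0 (≈-sym e)
  t∈ : t ∈[ a , b ]
  t∈ = ≤ᴿ-trans (proj₁ p∈) p≤t , ≤ᴿ-trans t≤q (proj₂ q∈)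
  1-θ≈ : 1ℝ - θ ≈ (t - p) * r
  1-θ≈ = ≈-via (((q - p) * r) - 1ℝ) (x-y≈0 e)
    λ n → solve 4 (λ p q t r → (con 1ℚᵘ :- (q :- t) :* r) :+ ((q :- p) :* r :- con 1ℚᵘ)
      := (t :- p) :* r) ℚ.≃-refl (seq p n) (seq q n) (seq t n) (seq r n)
  θ≤1 : θ ≤ 1ℝ
  θ≤1 = ≤-via (1ℝ - θ) (≤ᴿ-respʳ (≈-sym 1-θ≈) (0≤* (0≤y-x p≤t) r≥0))
    λ n → solve 1 (λ x → x :+ (con 1ℚᵘ :- x) := con 1ℚᵘ) ℚ.≃-refl (seq θ n)
  mix≈t : θ * p + (1ℝ - θ) * q ≈ t
  mix≈t = ≈-via ((1ℝ - (q - p) * r) * (t - q)) (null-* null)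
    λ n → solve 4 (λ p q t r → (((q :- t) :* r) :* p :+ (con 1ℚᵘ :- (q :- t) :* r) :* q)
        :+ (con 1ℚᵘ :- (q :- p) :* r) :* (t :- q) := t)
      ℚ.≃-refl (seq p n) (seq q n) (seq t n) (seq r n)

-- Convex hulls of finite point sets

*-mono-≤ʳ : ∀ {x y} z → 0ℝ ≤ z → x ≤ y → x * z ≤ y * z
*-mono-≤ʳ {x} {y} z h k = ≤-via ((y - x) * z) (0≤* (0≤y-x k) h)
  λ n → solve 3 (λ x y z → x :* z :+ (y :- x) :* z := y :* z) ℚ.≃-refl (seq x n) (seq y n) (seq z n)

*-mono-≤ˡ : ∀ {x y} z → 0ℝ ≤ z → x ≤ y → z * x ≤ z * y
*-mono-≤ˡ {x} {y} z h k =
  ≤ᴿ-respˡ (*ᴿ-comm x z) (≤ᴿ-respʳ (*ᴿ-comm y z) (*-mono-≤ʳ z h k))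

-ᴿ-monoˡ : ∀ {x y} z → x ≤ y → x - z ≤ y - z
-ᴿ-monoˡ {x} {y} z h = ≤-via (y - x) (0≤y-x h)
  λ n → solve 3 (λ x y z → (x :- z) :+ (y :- x) := y :- z) ℚ.≃-refl (seq x n) (seq y n) (seq z n)

-- The hull of the points (x k , y k), k ≤ M, is its Legendre biconjugate
-- restricted to the finitely many slopes of chords.
module Hull (M : ℕ) (x y : ℕ → ℝ) (gap : ∀ a d → Positive (x (d ℕ.+ suc a) - x a)) where

  -- Indexing a chord by its left end a and an offset d makes every chord have
  -- positive width.  Chords that leave the range k ≤ M contribute junk slopes,
  -- which do no harm: the line of any slope lies below all the points.
  slope : ℕ → ℕ → ℝ
  slope a d = (y (d ℕ.+ suc a) - y a) * proj₁ (recip (gap a d))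

  conjugate : ℝ → ℝ
  conjugate s = ⨆ M (λ k → s * x k - y k)

  line : ℝ → ℝ → ℝ
  line s t = s * t - conjugate s

  hull : ℝ → ℝ
  hull t = ⨆ M (λ a → ⨆ M (λ d → line (slope a d) t))

  line≤hull : ∀ {a d} t → a ℕ.≤ M → d ℕ.≤ M → line (slope a d) t ≤ hull t
  line≤hull {a} {d} t a≤ d≤ = ≤ᴿ-trans
    (⨆-upper M (λ d → line (slope a d) t) d d≤)
    (⨆-upper M (λ a → ⨆ M (λ d → line (slope a d) t)) a a≤)

  hull-lub : ∀ {t z} → (∀ a d → a ℕ.≤ M → d ℕ.≤ M → line (slope a d) t ≤ z) → hull t ≤ z
  hull-lub {t} h = ⨆-lub M _ λ a a≤ → ⨆-lub M _ λ d d≤ → h a d a≤ d≤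

  hull-mono-≈ : ∀ {s t} → s ≈ t → hull s ≤ hull t
  hull-mono-≈ {s} {t} s≈t = hull-lub {s} {hull t} λ a d a≤ d≤ →
    ≤ᴿ-trans {y = line (slope a d) t}
      (-ᴿ-monoˡ (conjugate (slope a d)) (≈⇒≤ (*ᴿ-congˡ (slope a d) s≈t)))
      (line≤hull t a≤ d≤)

  hull-extensional : ∀ {A B} → ExtensionalOn A B hull
  hull-extensional s t _ _ s≈t = ≤ᴿ-antisym (hull-mono-≈ s≈t) (hull-mono-≈ (≈-sym s≈t))

  hull-convex : ∀ {A B} → ConvexOn A B hull
  hull-convex s t θ _ _ (0≤θ , θ≤1) =
    hull-lub {θ * s + (1ℝ - θ) * t} {θ * hull s + (1ℝ - θ) * hull t} λ a d a≤ d≤ → ≤ᴿ-respˡ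
    {θ * line (slope a d) s + (1ℝ - θ) * line (slope a d) t}
    (≈-pointwise λ n → solve 5 (λ θ s t σ c →
        θ :* (σ :* s :- c) :+ (con 1ℚᵘ :- θ) :* (σ :* t :- c)
          := σ :* (θ :* s :+ (con 1ℚᵘ :- θ) :* t) :- c)
      ℚ.≃-refl (seq θ n) (seq s n) (seq t n) (seq (slope a d) n) (seq (conjugate (slope a d)) n))
    (+-mono (*-mono-≤ˡ θ 0≤θ (line≤hull s a≤ d≤))
      (*-mono-≤ˡ (1ℝ - θ) (0≤y-x θ≤1) (line≤hull t a≤ d≤)))

  hull-below : ∀ k → k ℕ.≤ M → hull (x k) ≤ y k
  hull-below k k≤ = hull-lub {x k} {y k} λ a d _ _ →
    let s = slope a d in
    ≤-via (conjugate s - (s * x k - y k)) (0≤y-x (⨆-upper M (λ k → s * x k - y k) k k≤))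
      λ n → solve 4 (λ s x y c → (s :* x :- c) :+ (c :- (s :* x :- y)) := y)
        ℚ.≃-refl (seq s n) (seq (x k) n) (seq (y k) n) (seq (conjugate s) n)

  chord : ℕ → ℕ → ℝ
  chord a b = slope a (b ℕ.∸ suc a)

  gap< : ∀ {a b} → a ℕ.< b → Positive (x b - x a)
  gap< {a} {b} a<b = subst (λ b → Positive (x b - x a)) (ℕ.m∸n+n≡m a<b) (gap a (b ℕ.∸ suc a))

  chord-reciprocal : ∀ {a b} → a ℕ.< b →
    ∃[ r ] (0ℝ ≤ r × (x b - x a) * r ≈ 1ℝ × chord a b ≈ (y b - y a) * r)
  chord-reciprocal {a} {b} a<b =
    let (r , r≥0 , e) = recip (gap a (b ℕ.∸ suc a))
    in r , r≥0
      , subst (λ c → (x c - x a) * r ≈ 1ℝ) (ℕ.m∸n+n≡m a<b) e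
      , subst (λ c → chord a b ≈ (y c - y a) * r) (ℕ.m∸n+n≡m a<b) ≈-refl

  chord-rise : ∀ {a b} → a ℕ.< b → chord a b * (x b - x a) ≈ y b - y a
  chord-rise {a} {b} a<b =
    let (r , _ , e , c) = chord-reciprocal a<b
    in ≈-trans (*ᴿ-congʳ (x b - x a) c)
      (≈-via ((1ℝ - (x b - x a) * r) * (y b - y a)) (null-* (x-y≈0 (≈-sym e)))
        λ n → solve 3 (λ u v r → (v :* r) :* u :+ (con 1ℚᵘ :- u :* r) :* v := v)
          ℚ.≃-refl (seq (x b - x a) n) (seq (y b - y a) n) (seq r n))

  -- (y a - y k) / (x a - x k) ≤ (y l - y a) / (x l - x a) for k < a < l, cleared
  -- of denominators; it is vacuous at a = 0, where the wrapping starts.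
  LeftConvex : ℕ → Set
  LeftConvex a = ∀ k l → k ℕ.< a → a ℕ.< l → l ℕ.≤ M →
    (y a - y k) * (x l - x a) ≤ (y l - y a) * (x a - x k)

  -- The line of slope `s` through point `a` stays below all the points; equivalently, the maximum
  -- in `conjugate s` is attained at `a`.
  Supports : ℝ → ℕ → Set
  Supports s a = ∀ k → k ℕ.≤ M → s * x k - y k ≤ s * x a - y a

  -- Points to the right of `a` lie above the chord because its slope is minimal. Points to the left
  -- do because, by `LeftConvex`, slopes into `a` are at most the slope from `a` to `b`.
  chord-supports : ∀ {a b} → a ℕ.< b → b ℕ.≤ M → LeftConvex a →
    (∀ c → a ℕ.< c → c ℕ.≤ M → chord a b ≤ chord a c) → Supports (chord a b) a
  chord-supports {a} {b} a<b b≤M left min k k≤M with ℕ.<-cmp k a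
  ... | tri≈ _ refl _ = ≤ᴿ-refl
  ... | tri> _ _ a<k  = ≤-via ((y k - y a) - s * (x k - x a))
      (0≤y-x (≤ᴿ-respʳ (chord-rise a<k)
        (*-mono-≤ʳ (x k - x a) (positive⇒0≤ (gap< a<k)) (min k a<k k≤M))))
      λ n → solve 5 (λ s xk yk xa ya →
          (s :* xk :- yk) :+ ((yk :- ya) :- s :* (xk :- xa)) := s :* xa :- ya)
        ℚ.≃-refl (seq s n) (seq (x k) n) (seq (y k) n) (seq (x a) n) (seq (y a) n)
    where
    s : ℝ
    s = chord a b
  ... | tri< k<a _ _  = ≤-via (s * (x a - x k) - (y a - y k))
      (0≤y-x (*-cancel-≤ {x b - x a} {y a - y k} {s * (x a - x k)} (recip (gap< a<b))
        (≤ᴿ-respʳ {y = (y b - y a) * (x a - x k)} scaled (left k b k<a a<b b≤M))))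
      λ n → solve 5 (λ s xk yk xa ya →
          (s :* xk :- yk) :+ (s :* (xa :- xk) :- (ya :- yk)) := s :* xa :- ya)
        ℚ.≃-refl (seq s n) (seq (x k) n) (seq (y k) n) (seq (x a) n) (seq (y a) n)
    where
    s : ℝ
    s = chord a b
    scaled : (y b - y a) * (x a - x k) ≈ (s * (x a - x k)) * (x b - x a)
    scaled = ≈-trans (*ᴿ-congʳ (x a - x k) (≈-sym (chord-rise a<b)))
      (≈-pointwise λ n → solve 3 (λ s u v → (s :* u) :* v := (s :* v) :* u)
        ℚ.≃-refl (seq s n) (seq (x b - x a) n) (seq (x a - x k) n))

  -- A supporting slope separates the slopes into `b` from those out of `b`; this renews the
  -- invariant of the wrapping at its next point.
  supports⇒leftConvex : ∀ {s b} → Supports s b → LeftConvex b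
  supports⇒leftConvex {s} {b} supp k l k<b b<l l≤M = ≤ᴿ-trans
    (*-mono-≤ʳ (x l - x b) (positive⇒0≤ (gap< b<l)) rise)
    (≤ᴿ-respˡ {(s * (x l - x b)) * (x b - x k)}
      (≈-pointwise λ n → solve 3 (λ s u v → (s :* u) :* v := (s :* v) :* u)
        ℚ.≃-refl (seq s n) (seq (x l - x b) n) (seq (x b - x k) n))
      (*-mono-≤ʳ (x b - x k) (positive⇒0≤ (gap< k<b)) rise′))
    where
    rise : y b - y k ≤ s * (x b - x k)
    rise = ≤-via ((s * x b - y b) - (s * x k - y k))
      (0≤y-x (supp k (ℕ.<⇒≤ (ℕ.<-≤-trans (ℕ.<-trans k<b b<l) l≤M))))
      λ n → solve 5 (λ s xk yk xb yb →
          (yb :- yk) :+ ((s :* xb :- yb) :- (s :* xk :- yk)) := s :* (xb :- xk))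
        ℚ.≃-refl (seq s n) (seq (x k) n) (seq (y k) n) (seq (x b) n) (seq (y b) n)
    rise′ : s * (x l - x b) ≤ y l - y b
    rise′ = ≤-via ((s * x b - y b) - (s * x l - y l)) (0≤y-x (supp l l≤M))
      λ n → solve 5 (λ s xk yk xb yb →
          s :* (xk :- xb) :+ ((s :* xb :- yb) :- (s :* xk :- yk)) := yk :- yb)
        ℚ.≃-refl (seq s n) (seq (x l) n) (seq (y l) n) (seq (x b) n) (seq (y b) n)

  module Largest {A B : ℝ} (x∈ : ∀ k → k ℕ.≤ M → x k ∈[ A , B ])
    (φ : ℝ → ℝ) (ext : ExtensionalOn A B φ) (conv : ConvexOn A B φ)
    (φ≤ : ∀ k → k ℕ.≤ M → φ (x k) ≤ y k) (t : ℝ) (t≤xM : t ≤ x M) where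

    -- Convexity puts `φ` below the chord on this interval. Since the chord supports at `a`,
    -- `conjugate s` is at most `s * x a - y a`, so the chord is below `line s`, one of the lines
    -- whose maximum is `hull`.
    under-chord : ∀ {a b} → a ℕ.< b → b ℕ.≤ M → Supports (chord a b) a →
                  x a ≤ t → t ≤ x b → φ t ≤ hull t
    under-chord {a} {b} a<b b≤M supp xa≤t t≤xb =
      let (r , r≥0 , e , c) = chord-reciprocal a<b
          u = x b - x a
          s = chord a b
          a≤M = ℕ.≤-trans (ℕ.<⇒≤ a<b) b≤M
          0≤rest : 0ℝ ≤ (y a - φ (x a)) * ((x b - t) * r) + (y b - φ (x b)) * ((t - x a) * r)
          0≤rest = 0≤+ (0≤* (0≤y-x (φ≤ a a≤M)) (0≤* (0≤y-x t≤xb) r≥0))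
                       (0≤* (0≤y-x (φ≤ b b≤M)) (0≤* (0≤y-x xa≤t) r≥0))
      in ≤ᴿ-trans {y = line s t}
        (≤ᴿ-trans (convex-chord φ ext conv (x∈ a a≤M) (x∈ b b≤M) xa≤t t≤xb r≥0 e)
          (≤ᴿ-trans {y = ((x b - t) * r) * y a + ((t - x a) * r) * y b}
            (≤-via _ 0≤rest
              λ n → solve 6 (λ p q fa fb ya yb → (p :* fa :+ q :* fb)
                  :+ ((ya :- fa) :* p :+ (yb :- fb) :* q) := p :* ya :+ q :* yb)
                ℚ.≃-refl (seq ((x b - t) * r) n) (seq ((t - x a) * r) n)
                  (seq (φ (x a)) n) (seq (φ (x b)) n) (seq (y a) n) (seq (y b) n))
            (≤ᴿ-trans {y = s * t - (s * x a - y a)}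
              (≈⇒≤ (≈-via ((1ℝ - u * r) * y a + (s - (y b - y a) * r) * (t - x a))
                (≈-trans {y = 0ℝ + 0ℝ}
                  (+ᴿ-cong (null-* (x-y≈0 (≈-sym e))) (null-* (x-y≈0 c)))
                  (≈-pointwise λ _ → ℚ.≃-refl))
                λ n → solve 7 (λ xa xb ya yb t r s →
                    (((xb :- t) :* r) :* ya :+ ((t :- xa) :* r) :* yb)
                      :+ ((con 1ℚᵘ :- (xb :- xa) :* r) :* ya :+ (s :- (yb :- ya) :* r) :* (t :- xa))
                      := s :* t :- (s :* xa :- ya))
                  ℚ.≃-refl (seq (x a) n) (seq (x b) n) (seq (y a) n) (seq (y b) n)
                    (seq t n) (seq r n) (seq s n)))
              (≤-via ((s * x a - y a) - conjugate s)
                (0≤y-x (⨆-lub M (λ k → s * x k - y k) supp))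
                λ n → solve 4 (λ s t v c → (s :* t :- v) :+ (v :- c) := s :* t :- c)
                  ℚ.≃-refl (seq s n) (seq t n) (seq (s * x a - y a) n) (seq (conjugate s) n)))))
        (line≤hull t a≤M (ℕ.≤-trans (ℕ.m∸n≤m b (suc a)) b≤M))

    -- Gift wrapping: from the hull point a, the chord of least slope leads to
    -- the next hull point b.
    wrap : ∀ fuel a → a ℕ.< M → M ℕ.≤ fuel ℕ.+ a → LeftConvex a → x a ≤ t → ¬ ¬ (φ t ≤ hull t)
    wrap zero       a a<M M≤a _ _ = contradiction M≤a (ℕ.<⇒≱ a<M)
    wrap (suc fuel) a a<M M≤ left xa≤t ¬goal =
      -- Offsets up to `M ∸ suc a` are those whose right end `d + suc a` is at most `M`, so no junk
      -- slope competes.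
      ¬¬argmin (M ℕ.∸ suc a) (slope a) λ (d , d≤ , min) →
        let b   = d ℕ.+ suc a
            a<b = ℕ.m≤n+m (suc a) d
            b≤M = ℕ.≤-trans (ℕ.+-monoˡ-≤ (suc a) d≤) (ℕ.≤-reflexive (ℕ.m∸n+n≡m a<M))
            supp = chord-supports a<b b≤M left
              (λ c a<c c≤M → subst (λ e → slope a e ≤ chord a c) (sym (ℕ.m+n∸n≡m d (suc a)))
                (min (c ℕ.∸ suc a) (ℕ.∸-monoˡ-≤ (suc a) c≤M)))
        in ≤-cases t (x b)
          (λ t≤xb ¬g → ¬g (under-chord a<b b≤M supp xa≤t t≤xb))
          (λ xb≤t → next b a<b b≤M supp xb≤t) ¬goal
      where
      next : ∀ b → a ℕ.< b → b ℕ.≤ M → Supports (chord a b) a → x b ≤ t → ¬ ¬ (φ t ≤ hull t)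
      next b a<b b≤M supp xb≤t with b ℕ.≟ M
      -- The last point has been reached, and `t ≤ x M` closes the interval.
      ... | yes refl = λ ¬g → ¬g (under-chord a<b b≤M supp xa≤t t≤xM)
      ... | no  b≢M  = wrap fuel b (ℕ.≤∧≢⇒< b≤M b≢M)
          (ℕ.≤-trans M≤ (ℕ.≤-trans (ℕ.≤-reflexive (sym (ℕ.+-suc fuel a))) (ℕ.+-monoʳ-≤ fuel a<b)))
          (supports⇒leftConvex {chord a b} λ k k≤M → ≤ᴿ-respʳ on-line (supp k k≤M)) xb≤t
        where
        s : ℝ
        s = chord a b
        on-line : s * x a - y a ≈ s * x b - y b
        on-line = ≈-via (s * (x b - x a) - (y b - y a)) (x-y≈0 (chord-rise a<b))
          λ n → solve 5 (λ s xk yk xa ya →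
              (s :* xa :- ya) :+ (s :* (xk :- xa) :- (yk :- ya)) := s :* xk :- yk)
            ℚ.≃-refl (seq s n) (seq (x b) n) (seq (y b) n) (seq (x a) n) (seq (y a) n)

    hull-largest : 0 ℕ.< M → x 0 ≤ t → φ t ≤ hull t
    hull-largest 0<M x0≤t = ≤-stable (wrap M 0 0<M (ℕ.≤-reflexive (sym (ℕ.+-identityʳ M)))
      (λ _ _ ()) x0≤t)

-- Logarithms and the convex minorant

-- Refining the mesh of a Riemann sum by a factor `M` is the reindexing `M *_`. After it the
-- harmonic sums in the logarithm laws agree term by term, so these laws need no estimates.
≈-subsequence : ∀ {x y} (g : ℕ → ℕ) → (∀ n → n ℕ.≤ g n) →
                (∀ n → seq x (g n) ℚ.≃ seq y n) → x ≈ y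
≈-subsequence {x} {y} g g≥ e = mk≈ λ ε ε>0 →
  let (N , h) = cauchy x ε ε>0
  in N , λ n N≤n → subst-close (seq x n) (seq x (g n)) (seq x n) (seq y n) ℚ.≃-refl (e n)
       (h n (g n) N≤n (ℕ.≤-trans N≤n (g≥ n)))

seq-log : ∀ p q .{{_ : NonZero p}} .{{_ : NonZero q}} N → seq (log (+ p ℚ./ q)) N ≡ logSeq p q N
seq-log (suc p) (suc q) N = refl

log1≈0 : logℕ 1 ≈ 0ℝ
log1≈0 = ≈-pointwise λ n → ℚ.+-inverseʳ (harmonic (1 ℕ.* n))

log-ratio : ∀ m k M .{{_ : NonZero m}} .{{_ : NonZero k}} .{{_ : NonZero M}}
            .{{_ : NonZero (m ℕ.* M)}} .{{_ : NonZero (k ℕ.* M)}} →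
            log (+ (m ℕ.* M) ℚ./ (k ℕ.* M)) ≈ logℕ m - logℕ k
log-ratio m k M = ≈-sym (≈-subsequence (M ℕ.*_) (λ n → ℕ.m≤n*m n M) λ n → ℚ.≃-trans
  (ℚ.≃-reflexive (cong₂ ℚ._-_ (seq-log m 1 (M ℕ.* n)) (seq-log k 1 (M ℕ.* n))))
  (ℚ.≃-trans (solve 3 (λ a b c → (a :- c) :- (b :- c) := a :- b) ℚ.≃-refl
      (harmonic (m ℕ.* (M ℕ.* n))) (harmonic (k ℕ.* (M ℕ.* n))) (harmonic (1 ℕ.* (M ℕ.* n))))
    (ℚ.≃-reflexive (trans
      (sym (cong₂ (λ a b → harmonic a ℚ.- harmonic b) (ℕ.*-assoc m M n) (ℕ.*-assoc k M n)))
      (sym (seq-log (m ℕ.* M) (k ℕ.* M) n))))))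

-- log (m M / M) is both log (m M) - log M and log m.
logℕ-* : ∀ m M .{{_ : NonZero m}} .{{_ : NonZero M}} .{{_ : NonZero (m ℕ.* M)}} →
         logℕ (m ℕ.* M) ≈ logℕ m + logℕ M
logℕ-* m M = ≈-trans {y = (logℕ (m ℕ.* M) - logℕ M) + logℕ M}
  (≈-pointwise λ n → solve 2 (λ a b → a := (a :- b) :+ b) ℚ.≃-refl
    (seq (logℕ (m ℕ.* M)) n) (seq (logℕ M) n))
  (+ᴿ-cong (≈-sym (≈-subsequence (M ℕ.*_) (λ n → ℕ.m≤n*m n M) log-quotient)) (≈-refl {logℕ M}))
  where
  log-quotient : ∀ n → seq (logℕ m) (M ℕ.* n) ℚ.≃ seq (logℕ (m ℕ.* M) - logℕ M) n
  log-quotient n = ℚ.≃-sym (ℚ.≃-trans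
    (ℚ.≃-reflexive (cong₂ ℚ._-_ (seq-log (m ℕ.* M) 1 n) (seq-log M 1 n)))
    (ℚ.≃-trans (solve 3 (λ a b c → (a :- c) :- (b :- c) := a :- b) ℚ.≃-refl
      (harmonic (m ℕ.* M ℕ.* n)) (harmonic (M ℕ.* n)) (harmonic (1 ℕ.* n)))
      (ℚ.≃-reflexive (trans
        (cong₂ (λ a b → harmonic a ℚ.- harmonic b) (ℕ.*-assoc m M n) (sym (ℕ.*-identityˡ (M ℕ.* n))))
        (sym (seq-log m 1 (M ℕ.* n)))))))

nat-mono : ∀ {j k} → j ℕ.≤ k → nat j ℚ.≤ nat k
nat-mono h = *≤* (ℤ.*-monoʳ-≤-nonNeg (+ 1) (ℤ.+≤+ h))

inv-nonNegative : ∀ b .{{_ : NonZero b}} → ℚ.NonNegative (inv b)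
inv-nonNegative (suc b) = _

-- Between `a * N` and `b * N` there are `suc d * N` terms, each at least `1 / (b * N)`; already `N`
-- of them sum to `1 / b`, a bound free of `N` that survives in the limit.
harmonic-gap : ∀ a d n → let b = suc (d ℕ.+ a); N = suc n in
  inv b ℚ.≤ harmonic (b ℕ.* N) ℚ.- harmonic (a ℕ.* N)
harmonic-gap a d n = ℚ.≤-trans
  (ℚ.≤-reflexive (ℚ.≃-sym (ℚ.≃-trans
    (ℚ.≃-reflexive (cong (λ k → nat N ℚ.* k) (inv-cong (ℕ.*-comm b N)))) (nat*inv n (d ℕ.+ a)))))
  (ℚ.≤-trans (ℚ.*-monoˡ-≤-nonNeg (inv (b ℕ.* N)) {{inv-nonNegative (b ℕ.* N)}}
      (nat-mono (ℕ.m≤m+n N (d ℕ.* N))))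
    (ℚ.≤-trans
      (ℚ.≤-reflexive (solve 2 (λ h k → k := (h :+ k) :- h) ℚ.≃-refl
        (harmonic (a ℕ.* N)) (nat (suc d ℕ.* N) ℚ.* inv (b ℕ.* N))))
      (ℚ.+-monoˡ-≤ (ℚ.- harmonic (a ℕ.* N))
        (subst (λ k → harmonic (a ℕ.* N) ℚ.+ nat (suc d ℕ.* N) ℚ.* inv (b ℕ.* N) ℚ.≤ harmonic k)
          (sym (ℕ.*-distribʳ-+ N (suc d) a))
          (block-lower (a ℕ.* N) (b ℕ.* N) (suc d ℕ.* N)
            (ℕ.≤-reflexive (sym (ℕ.*-distribʳ-+ N (suc d) a))))))))
  where
  b = suc (d ℕ.+ a)
  N = suc n
  inv-cong : ∀ {j k} .{{_ : NonZero j}} .{{_ : NonZero k}} → j ≡ k → inv j ≡ inv k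
  inv-cong refl = refl

logℕ-gap : ∀ a d → Positive (logℕ (suc (d ℕ.+ suc a)) - logℕ (suc a))
-- The bound starts at index 1, because every logarithm sequence is 0 at index 0.
logℕ-gap a d = mkPositive (inv b) (ℚ.positive⁻¹ (inv b)) (1 , λ { (suc n) _ →
  ℚ.≤-respʳ-≃ (solve 3 (λ a b c → b :- a := (b :- c) :- (a :- c)) ℚ.≃-refl
      (harmonic (suc a ℕ.* suc n)) (harmonic (b ℕ.* suc n)) (harmonic (1 ℕ.* suc n)))
    (harmonic-gap (suc a) d n) })
  where
  b = suc (d ℕ.+ suc a)

logℕ-< : ∀ a b .{{_ : NonZero a}} → a ℕ.< b → Positive (logℕ b - logℕ a)
logℕ-< (suc a) b a<b = subst (λ b → Positive (logℕ b - logℕ (suc a)))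
  (trans (sym (ℕ.+-suc (b ℕ.∸ suc (suc a)) (suc a))) (ℕ.m∸n+n≡m a<b))
  (logℕ-gap a (b ℕ.∸ suc (suc a)))

logℕ-mono : ∀ a b .{{_ : NonZero a}} → a ℕ.≤ b → logℕ a ≤ logℕ b
logℕ-mono a b a≤b with a ℕ.≟ b
... | yes refl = ≤ᴿ-refl
... | no  a≢b  = ≤-via (logℕ b - logℕ a) (positive⇒0≤ (logℕ-< a b (ℕ.≤∧≢⇒< a≤b a≢b)))
  λ n → solve 2 (λ a b → a :+ (b :- a) := b) ℚ.≃-refl (seq (logℕ a) n) (seq (logℕ b) n)

0≤logℕ : ∀ k .{{_ : NonZero k}} → 0ℝ ≤ logℕ k
0≤logℕ (suc k) = ≤ᴿ-respˡ log1≈0 (logℕ-mono 1 (suc k) (s≤s z≤n))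

convexMinorant : ∀ {m} (G : Graph m) → 2 ℕ.≤ m → Σ[ ψ ∈ (ℝ → ℝ) ] IsConvexMinorant G ψ
convexMinorant {suc zero}    G (s≤s ())
convexMinorant {suc (suc M)} G _ = hull , record
  { isConvexBelow = record
    { extensional = hull-extensional
    ; convex      = hull-convex
    ; below       = λ { (suc k) (s≤s k≤) → hull-below k k≤ }
    }
  ; largest = λ φ φ-below t (0≤t , t≤) → let open IsConvexBelow φ-below in
      Largest.hull-largest x∈ φ extensional convex (λ k k≤ → below (suc k) (s≤s k≤)) t t≤
        (s≤s z≤n) (≤ᴿ-respˡ (≈-sym log1≈0) 0≤t)
  }
  where
  x y : ℕ → ℝ
  x k = logℕ (suc k)
  y k = fromℚ (i G (suc k))
  -- Index `k` carries the point of size `k + 1`, so the last index is one less than the number of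
  -- vertices.
  open Hull (suc M) x y logℕ-gap
  x∈ : ∀ k → k ℕ.≤ suc M → x k ∈[ 0ℝ , logℕ (suc (suc M)) ]
  x∈ k k≤ = 0≤logℕ (suc k) , logℕ-mono (suc k) (suc (suc M)) (s≤s k≤)

affine-extensional : ∀ c d {a b} → ExtensionalOn a b (λ t → c * t + d)
affine-extensional c d s t _ _ s≈t = +ᴿ-cong (*ᴿ-congˡ c s≈t) (≈-refl {d})

affine-convex : ∀ c d {a b} → ConvexOn a b (λ t → c * t + d)
affine-convex c d s t θ _ _ _ = ≈⇒≤ (≈-pointwise λ n →
  solve 5 (λ c d s t θ → c :* (θ :* s :+ (con 1ℚᵘ :- θ) :* t) :+ d
      := θ :* (c :* s :+ d) :+ (con 1ℚᵘ :- θ) :* (c :* t :+ d))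
    ℚ.≃-refl (seq c n) (seq d n) (seq s n) (seq t n) (seq θ n))

-- Affine convex minorants

module Minorant {m} (G : Graph m) (2≤m : 2 ℕ.≤ m)
                (ψ : ℝ → ℝ) (minorant : IsConvexMinorant G ψ) where

  open IsConvexMinorant minorant
  open IsConvexBelow isConvexBelow

  private
    instance
      m≢0 : NonZero m
      m≢0 = ℕ.>-nonZero (ℕ.≤-trans (s≤s z≤n) 2≤m)

    1≤m : 1 ℕ.≤ m
    1≤m = ℕ.≤-trans (s≤s z≤n) 2≤m

    L : ℝ
    L = logℕ m

    height : ∀ k → .{{NonZero k}} → ℝ
    height k = fromℚ (i G k)

  0≤L : 0ℝ ≤ L
  0≤L = 0≤logℕ m

  -- Both criteria below test the maximality of `ψ` against affine functions only.
  largest-affine : ∀ c d →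
    (∀ k .{{_ : NonZero k}} → k ℕ.≤ m → c * logℕ k + d ≤ fromℚ (i G k)) →
    ∀ t → t ∈[ 0ℝ , L ] → c * t + d ≤ ψ t
  largest-affine c d h = largest (λ t → c * t + d) (record
    { extensional = affine-extensional c d
    ; convex      = affine-convex c d
    ; below       = h
    })

  -- If `ψ` is `c t + e`, comparison with two test lines gives `e ≥ i G 1` and `c L + e ≥ 0`. With
  -- `l = log k`, the value `(c l + e) L` equals `(L - l) e + l (c L + e)`, which is therefore at
  -- least `(L - l) (i G 1)`.
  affine⇒above-chord : (∀ k .{{_ : NonZero k}} → 0ℝ ≤ fromℚ (i G k)) →
    AffineOn 0ℝ L ψ → ∀ k .{{_ : NonZero k}} → k ℕ.≤ m →
    fromℚ (i G 1) * (L - logℕ k) ≤ fromℚ (i G k) * L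
  affine⇒above-chord nonneg (c , e , ψ≈) k k≤m =
    ≤-via ((height k - (c * l + e)) * L + (c * L + e) * l + (e - height 1) * (L - l))
      (0≤+ (0≤+ (0≤* (0≤y-x at-k) 0≤L) (0≤* at-L (0≤logℕ k)))
        (0≤* (0≤y-x at-0) (0≤y-x (logℕ-mono k m k≤m))))
      λ n → solve 6 (λ c e y z l L →
          z :* (L :- l) :+ ((y :- (c :* l :+ e)) :* L :+ (c :* L :+ e) :* l :+ (e :- z) :* (L :- l))
            := y :* L)
        ℚ.≃-refl (seq c n) (seq e n) (i G k) (i G 1) (seq l n) (seq L n)
    where
    l : ℝ
    l = logℕ k
    r : HasReciprocal (logℕ 2 - logℕ 1)
    r = recip (logℕ-< 1 2 ℕ.≤-refl)
    r₂ : ℝ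
    r₂ = proj₁ r
    -- The slope of a line through (0 , i₁) that vanishes at log 2.
    s : ℝ
    s = height 1 * r₂
    0≤s : 0ℝ ≤ s
    0≤s = 0≤* (nonneg 1) (proj₁ (proj₂ r))
    at-k : c * l + e ≤ height k
    at-k = ≤ᴿ-respˡ (ψ≈ l (0≤logℕ k , logℕ-mono k m k≤m)) (below k k≤m)
    at-L : 0ℝ ≤ c * L + e
    at-L = ≤ᴿ-respʳ (ψ≈ L (0≤L , ≤ᴿ-refl)) (≤ᴿ-respˡ {0ℝ * L + 0ℝ}
      (≈-pointwise λ n → solve 1 (λ L → con 0ℚᵘ :* L :+ con 0ℚᵘ := con 0ℚᵘ) ℚ.≃-refl (seq L n))
      (largest-affine 0ℝ 0ℝ (λ k _ → ≤ᴿ-respˡ (≈-pointwise λ n →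
          solve 1 (λ l → con 0ℚᵘ := con 0ℚᵘ :* l :+ con 0ℚᵘ) ℚ.≃-refl (seq (logℕ k) n)) (nonneg k))
        L (0≤L , ≤ᴿ-refl)))
    -- At `k = 1` the line passes through the point itself; from `log 2` on it is at most 0 and so
    -- below every height.
    steep : ∀ k .{{_ : NonZero k}} → k ℕ.≤ m → (0ℝ - s) * logℕ k + height 1 ≤ height k
    steep 1 _ = ≈⇒≤ (≈-via (logℕ 1 * s) (null-* log1≈0) λ n →
      solve 3 (λ s l z → ((con 0ℚᵘ :- s) :* l :+ z) :+ l :* s := z)
        ℚ.≃-refl (seq s n) (seq (logℕ 1) n) (i G 1))
    steep (suc (suc k)) _ =
      ≤-via (s * (logℕ k₂ - logℕ 2) + height k₂ + ((logℕ 2 - logℕ 1) * r₂ - 1ℝ) * height 1 + logℕ 1 * s)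
        (0≤+ (0≤+ (0≤+ (0≤* 0≤s (0≤y-x (logℕ-mono 2 k₂ (s≤s (s≤s z≤n))))) (nonneg k₂))
          (≈⇒≤ (≈-sym (null-* (x-y≈0 (proj₂ (proj₂ r))))))) (≈⇒≤ (≈-sym (null-* log1≈0))))
        λ n → solve 6 (λ r l l₂ l₁ y z → let s = z :* r in
            ((con 0ℚᵘ :- s) :* l :+ z)
              :+ (s :* (l :- l₂) :+ y :+ ((l₂ :- l₁) :* r :- con 1ℚᵘ) :* z :+ l₁ :* s) := y)
          ℚ.≃-refl (seq r₂ n) (seq (logℕ k₂) n) (seq (logℕ 2) n) (seq (logℕ 1) n) (i G k₂) (i G 1)
      where
      k₂ : ℕ
      k₂ = suc (suc k)
    at-0 : height 1 ≤ e
    at-0 = ≤ᴿ-trans {y = (0ℝ - s) * 0ℝ + height 1}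
      (≈⇒≤ (≈-pointwise λ n → solve 2 (λ s z → z := (con 0ℚᵘ :- s) :* con 0ℚᵘ :+ z)
        ℚ.≃-refl (seq s n) (i G 1)))
      (≤ᴿ-trans (largest-affine (0ℝ - s) (height 1) steep 0ℝ (≤ᴿ-refl , 0≤L))
        (≤ᴿ-respʳ (≈-pointwise λ n → solve 2 (λ c e → c :* con 0ℚᵘ :+ e := e)
            ℚ.≃-refl (seq c n) (seq e n))
          (≈⇒≤ (ψ≈ 0ℝ (≤ᴿ-refl , 0≤L)))))

  -- The line `c (L - t)` is itself a competitor, hence below `ψ`. Conversely, convexity puts `ψ`
  -- below the chord of its end values, which are at most `c L` and `0`.
  above-chord⇒affine : ∀ c →
    (∀ k .{{_ : NonZero k}} → k ℕ.≤ m → c * (L - logℕ k) ≤ fromℚ (i G k)) →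
    fromℚ (i G 1) ≤ c * L → fromℚ (i G m) ≤ 0ℝ → AffineOn 0ℝ L ψ
  above-chord⇒affine c chord i₁≤ iₘ≤ = 0ℝ - c , c * L , λ t t∈ →
    ≤ᴿ-antisym (upper t t∈) (largest-affine (0ℝ - c) (c * L)
      (λ k k≤m → ≤ᴿ-respˡ (≈-pointwise λ n →
        solve 3 (λ c l L → c :* (L :- l) := (con 0ℚᵘ :- c) :* l :+ c :* L) ℚ.≃-refl
          (seq c n) (seq (logℕ k) n) (seq L n)) (chord k k≤m)) t t∈)
    where
    o : ℝ
    o = logℕ 1
    upper : ∀ t → t ∈[ 0ℝ , L ] → ψ t ≤ (0ℝ - c) * t + c * L
    upper t (0≤t , t≤L) =
      let (r , r≥0 , e) = recip (logℕ-< 1 m 2≤m)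
          o≤t = ≤ᴿ-respˡ (≈-sym log1≈0) 0≤t
          p = (L - t) * r
          q = (t - o) * r
          p≥0 = 0≤* (0≤y-x t≤L) r≥0
          q≥0 = 0≤* (0≤y-x o≤t) r≥0
      in ≤ᴿ-trans
        (convex-chord ψ extensional convex (0≤logℕ 1 , logℕ-mono 1 m 1≤m) (0≤L , ≤ᴿ-refl)
          o≤t t≤L r≥0 e)
        (≤-via ((c * L - ψ o) * p + (0ℝ - ψ L) * q
                -- These two summands are null: `r` inverts `L - o`, and `o` is 0, only up to `_≈_`.
                + (1ℝ - (L - o) * r) * (c * (L - t)) + o * ((0ℝ - r) * (c * (L - t))))
          (0≤+ (0≤+ (0≤+ (0≤* (0≤y-x (≤ᴿ-trans (below 1 1≤m) i₁≤)) p≥0)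
              (0≤* (0≤y-x (≤ᴿ-trans (below m ℕ.≤-refl) iₘ≤)) q≥0))
            (≈⇒≤ (≈-sym (null-* (x-y≈0 (≈-sym e)))))) (≈⇒≤ (≈-sym (null-* log1≈0))))
          λ n → solve 7 (λ c L t r o f g →
              ((L :- t) :* r :* f :+ (t :- o) :* r :* g)
                :+ ((c :* L :- f) :* ((L :- t) :* r) :+ (con 0ℚᵘ :- g) :* ((t :- o) :* r)
                  :+ (con 1ℚᵘ :- (L :- o) :* r) :* (c :* (L :- t))
                  :+ o :* ((con 0ℚᵘ :- r) :* (c :* (L :- t))))
                := (con 0ℚᵘ :- c) :* t :+ c :* L)
            ℚ.≃-refl (seq c n) (seq L n) (seq t n) (seq r n) (seq o n) (seq (ψ o) n) (seq (ψ L) n))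

-- Counting edges

-- The image of the head is cut out of `ys`, and injectivity keeps the images of the tail in what
-- remains. Edges and neighbours are compared below through such injections.
length-≤ : ∀ {A B : Set} (f : A → B) {xs ys} → Unique xs →
  (∀ {x} → x ∈ˡ xs → f x ∈ˡ ys) →
  (∀ {x x′} → x ∈ˡ xs → x′ ∈ˡ xs → f x ≡ f x′ → x ≡ x′) →
  length xs ℕ.≤ length ys
length-≤ f {[]}     _             _  _   = z≤n
length-≤ f {x ∷ xs} (x∉xs ∷ uniq) f∈ inj with ∈-∃++ (f∈ (here refl))
... | as , bs , refl = ℕ.≤-trans
  (s≤s (length-≤ f uniq f∈′ λ p q → inj (there p) (there q)))
  (ℕ.≤-reflexive (sym (List.length-++-sucʳ as (f x) bs)))
  where
  f∈′ : ∀ {y} → y ∈ˡ xs → f y ∈ˡ as ++ bs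
  f∈′ {y} y∈ with ∈-++⁻ as (f∈ (there y∈))
  ... | inj₁ p           = ∈-++⁺ˡ p
  ... | inj₂ (there p)   = ∈-++⁺ʳ as p
  ... | inj₂ (here fy≡fx) = contradiction (inj (here refl) (there y∈) (sym fy≡fx)) (All.lookup x∉xs y∈)

length-filter-map : ∀ {A B : Set} {P : B → Set} (P? : Decidable P) (f : A → B) xs →
  length (filter P? (map f xs)) ≡ length (filter (P? ∘ f) xs)
length-filter-map P? f []       = refl
length-filter-map P? f (x ∷ xs) with does (P? (f x))
... | true  = cong suc (length-filter-map P? f xs)
... | false = length-filter-map P? f xs

length-filter-cartesianProduct : ∀ {A B : Set} {P : A × B → Set} (P? : Decidable P) d xs ys →
  (∀ x → length (filter (λ y → P? (x , y)) ys) ≡ d) →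
  length (filter P? (cartesianProduct xs ys)) ≡ length xs ℕ.* d
length-filter-cartesianProduct P? d []       ys h = refl
length-filter-cartesianProduct P? d (x ∷ xs) ys h =
  trans (cong length (List.filter-++ P? (map (x ,_) ys) (cartesianProduct xs ys)))
    (trans (List.length-++ (filter P? (map (x ,_) ys)))
      (cong₂ ℕ._+_ (trans (length-filter-map P? (x ,_) ys) (h x))
        (length-filter-cartesianProduct P? d xs ys h)))

length-cartesianProduct : ∀ {A B : Set} (xs : List A) (ys : List B) →
  length (cartesianProduct xs ys) ≡ length xs ℕ.* length ys
length-cartesianProduct []       ys = refl
length-cartesianProduct (x ∷ xs) ys = trans (List.length-++ (map (x ,_) ys))
  (cong₂ ℕ._+_ (List.length-map (x ,_) ys) (length-cartesianProduct xs ys))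

length-allFin : ∀ n → length (allFin n) ≡ n
length-allFin n = List.length-tabulate {n = n} (λ k → k)

-- The minimum in `i` and its values at the extreme sizes

⊓-selective : ∀ p q → (p ℚ.⊓ q ≡ p) ⊎ (p ℚ.⊓ q ≡ q)
⊓-selective p@record{} q@record{} with p ℚ.≤ᵇ q
... | true  = inj₁ refl
... | false = inj₂ refl

minimum-≤ : ∀ {xs q} → q ∈ˡ xs → minimum xs ℚ.≤ q
minimum-≤ {q ∷ []}     (here refl) = ℚ.≤-refl
minimum-≤ {q ∷ r ∷ rs} (here refl) = ℚ.p⊓q≤p q (minimum (r ∷ rs))
minimum-≤ {q ∷ r ∷ rs} (there q∈)  = ℚ.≤-trans (ℚ.p⊓q≤q q (minimum (r ∷ rs))) (minimum-≤ q∈)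

minimum-∈ : ∀ q qs → minimum (q ∷ qs) ∈ˡ q ∷ qs
minimum-∈ q []       = here refl
minimum-∈ q (r ∷ rs) with ⊓-selective q (minimum (r ∷ rs))
... | inj₁ e = here e
... | inj₂ e = there (subst (_∈ˡ r ∷ rs) (sym e) (minimum-∈ r rs))

∈-subsets : ∀ {m} (A : Subset m) → A ∈ˡ subsets m
∈-subsets []                        = here refl
∈-subsets {suc m} (true  ∷ A)       = ∈-++⁺ˡ (∈-map⁺ (inside ∷_) (∈-subsets A))
∈-subsets {suc m} (false ∷ A)       =
  ∈-++⁺ʳ (map (inside ∷_) (subsets m)) (∈-map⁺ (outside ∷_) (∈-subsets A))

subset-of-size : ∀ m k → k ℕ.≤ m → ∃[ A ] (∣_∣ {m} A ≡ k)
subset-of-size m       zero    _       = ⊥ , Subset.∣⊥∣≡0 m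
subset-of-size (suc m) (suc k) (s≤s h) =
  let (A , e) = subset-of-size m k h in inside ∷ A , cong suc e

i≤ : ∀ {m} (G : Graph m) A k .{{_ : NonZero k}} → ∣ A ∣ ≡ k → i G k ℚ.≤ + boundary G A ℚ./ k
i≤ G A k e = minimum-≤ (∈-map⁺ _ (∈-filter⁺ (λ A → ∣ A ∣ ℕ.≟ k) (∈-subsets A) e))

∈-minimum-map : ∀ {A : Set} (f : A → ℚᵘ) {x xs} → x ∈ˡ xs →
                ∃[ y ] (y ∈ˡ xs × minimum (map f xs) ≡ f y)
∈-minimum-map f {xs = x ∷ xs} _ = unmap (minimum-∈ (f x) (map f xs))
  where
  unmap : ∀ {q ys} → q ∈ˡ map f ys → ∃[ y ] (y ∈ˡ ys × q ≡ f y)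
  unmap {ys = _ ∷ _} (here e)  = _ , here refl , e
  unmap {ys = _ ∷ _} (there p) = let (y , y∈ , e) = unmap p in y , there y∈ , e

i-attained : ∀ {m} (G : Graph m) k .{{_ : NonZero k}} → k ℕ.≤ m →
             ∃[ A ] (∣ A ∣ ≡ k × i G k ≡ + boundary G A ℚ./ k)
i-attained {m} G k k≤m =
  let (B , ∣B∣≡k)  = subset-of-size m k k≤m
      (A , A∈ , e) = ∈-minimum-map (λ A → + boundary G A ℚ./ k)
                       (∈-filter⁺ (λ A → ∣ A ∣ ℕ.≟ k) (∈-subsets B) ∣B∣≡k)
  in A , proj₂ (∈-filter⁻ (λ A → ∣ A ∣ ℕ.≟ k) {xs = subsets m} A∈) , e

0≤n/k : ∀ n k .{{_ : NonZero k}} → 0ℚᵘ ℚ.≤ + n ℚ./ k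
0≤n/k n (suc k) = ℚ.nonNegative⁻¹ (+ n ℚ./ suc k)

0≤i : ∀ {m} (G : Graph m) k .{{_ : NonZero k}} → 0ℚᵘ ℚ.≤ i G k
0≤i {m} G k = go (filter (λ A → ∣ A ∣ ℕ.≟ k) (subsets m))
  where
  go : ∀ As → 0ℚᵘ ℚ.≤ minimum (map (λ A → + boundary G A ℚ./ k) As)
  -- For `k > m` there is no subset of size `k`, and `minimum` takes its default value 0.
  go []       = ℚ.≤-refl
  go (A ∷ As) = let (B , _ , e) = ∈-minimum-map (λ A → + boundary G A ℚ./ k) {A} {A ∷ As} (here refl)
    in subst (0ℚᵘ ℚ.≤_) (sym e) (0≤n/k (boundary G B) k)

n/1-mono : ∀ {a b} → a ℕ.≤ b → + a ℚ./ 1 ℚ.≤ + b ℚ./ 1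
n/1-mono h = *≤* (ℤ.*-monoʳ-≤-nonNeg (+ 1) (ℤ.+≤+ h))

module _ {m} (G : Graph m) where
  open Graph G

  private
    crossing? : (A : Subset m) →
      Decidable (λ (e : Fin m × Fin m) → proj₁ e ∈ A × proj₂ e ∈ ∁ A × Adj (proj₁ e) (proj₂ e))
    crossing? A (u , v) = (u Subset.∈? A) ×-dec (v Subset.∈? ∁ A) ×-dec adj? u v

  crossing : Subset m → List (Fin m × Fin m)
  crossing A = filter (crossing? A) (cartesianProduct (allFin m) (allFin m))

  crossing-unique : ∀ A → Unique (crossing A)
  crossing-unique A = Unique.filter⁺ (crossing? A)
    (Unique.cartesianProduct⁺ (Unique.allFin⁺ m) (Unique.allFin⁺ m))

  ∈-crossing⁺ : ∀ {A u v} → u ∈ A → v ∉ A → Adj u v → (u , v) ∈ˡ crossing A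
  ∈-crossing⁺ {A} {u} {v} u∈ v∉ e = ∈-filter⁺ (crossing? A)
    (∈-cartesianProduct⁺ (∈-allFin u) (∈-allFin v)) (u∈ , Subset.x∉p⇒x∈∁p v∉ , e)

  ∈-crossing⁻ : ∀ {A u v} → (u , v) ∈ˡ crossing A → u ∈ A × v ∉ A × Adj u v
  ∈-crossing⁻ {A} uv∈ =
    let (u∈ , v∈ , e) = proj₂ (∈-filter⁻ (crossing? A) {xs = cartesianProduct (allFin m) (allFin m)} uv∈)
    in u∈ , Subset.x∈∁p⇒x∉p v∈ , e

  neighbours : Fin m → List (Fin m)
  neighbours v = filter (adj? v) (allFin m)

  neighbours-unique : ∀ v → Unique (neighbours v)
  neighbours-unique v = Unique.filter⁺ (adj? v) (Unique.allFin⁺ m)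

  ∈-neighbours⁺ : ∀ {v w} → Adj v w → w ∈ˡ neighbours v
  ∈-neighbours⁺ {v} {w} = ∈-filter⁺ (adj? v) (∈-allFin w)

  ∈-neighbours⁻ : ∀ {v w} → w ∈ˡ neighbours v → Adj v w
  ∈-neighbours⁻ {v} w∈ = proj₂ (∈-filter⁻ (adj? v) {xs = allFin m} w∈)

  -- Irreflexivity does the work: `u` is the only member of `A`, so every neighbour of `u` lies
  -- outside.
  degree≤boundary : ∀ u A → ∣ A ∣ ≡ 1 → u ∈ A → degree G u ℕ.≤ boundary G A
  degree≤boundary u A ∣A∣≡1 u∈A = length-≤ (u ,_) (neighbours-unique u)
    (λ {w} w∈ → let e = ∈-neighbours⁻ w∈ in
      ∈-crossing⁺ u∈A (λ w∈A → irrefl (only w∈A) e) e)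
    λ { _ _ refl → refl }
    where
    only : ∀ {w} → w ∈ A → u ≡ w
    only {w} w∈A with u Fin.≟ w
    ... | yes e = e
    ... | no u≢w = contradiction
      (ℕ.≤-trans (ℕ.≤-reflexive (cong suc (sym (Subset.∣⁅x⁆∣≡1 w))))
        (ℕ.≤-trans (Subset.p⊂q⇒∣p∣<∣q∣ {p = ⁅ w ⁆} {A}
          ((λ x∈ → subst (_∈ A) (sym (Subset.x∈⁅y⁆⇒x≡y w x∈)) w∈A) , u , u∈A , Subset.x≢y⇒x∉⁅y⁆ u≢w))
          (ℕ.≤-reflexive ∣A∣≡1)))
      λ { (s≤s ()) }

  boundary-singleton-≤ : ∀ u → boundary G ⁅ u ⁆ ℕ.≤ degree G u
  boundary-singleton-≤ u = length-≤ proj₂ (crossing-unique ⁅ u ⁆)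
    (λ uv∈ → let (u′∈ , _ , e) = ∈-crossing⁻ uv∈ in
      ∈-neighbours⁺ (subst (λ u → Adj u _) (Subset.x∈⁅y⁆⇒x≡y u u′∈) e))
    λ {(a , b)} {(c , d)} p q b≡d → cong₂ _,_
      (trans (Subset.x∈⁅y⁆⇒x≡y u (proj₁ (∈-crossing⁻ p)))
        (sym (Subset.x∈⁅y⁆⇒x≡y u (proj₁ (∈-crossing⁻ q))))) b≡d

  i₁-≥ : ∀ d → 1 ℕ.≤ m → (∀ u → d ℕ.≤ degree G u) → + d ℚ./ 1 ℚ.≤ i G 1
  i₁-≥ d 1≤m h =
    let (A , ∣A∣≡1 , e) = i-attained G 1 1≤m
        (u , u∈A)       = nonempty A (ℕ.≤-reflexive (sym ∣A∣≡1))
    in subst (+ d ℚ./ 1 ℚ.≤_) (sym e)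
        (n/1-mono (ℕ.≤-trans (h u) (degree≤boundary u A ∣A∣≡1 u∈A)))
    where
    nonempty : ∀ {n} (A : Subset n) → 1 ℕ.≤ ∣ A ∣ → ∃[ u ] (u ∈ A)
    nonempty (true  ∷ A) _ = zero , Vec.here
    nonempty (false ∷ A) h = let (u , u∈) = nonempty A h in suc u , Vec.there u∈

  i₁-≤ : ∀ u → i G 1 ℚ.≤ + degree G u ℚ./ 1
  i₁-≤ u = ℚ.≤-trans (i≤ G ⁅ u ⁆ 1 (Subset.∣⁅x⁆∣≡1 u)) (n/1-mono (boundary-singleton-≤ u))

  iₘ-≤ : .{{_ : NonZero m}} → i G m ℚ.≤ 0ℚᵘ
  iₘ-≤ = ℚ.≤-trans (i≤ G ⊤ m (Subset.∣⊤∣≡n m))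
    (ℚ.≤-reflexive (zero/ (boundary G ⊤) m (ℕ.n≤0⇒n≡0
      (length-≤ (λ e → e) {ys = []} (crossing-unique ⊤)
        (λ uv∈ → contradiction Subset.∈⊤ (proj₁ (proj₂ (∈-crossing⁻ uv∈)))) λ _ _ e → e))))
    where
    zero/ : ∀ b k .{{_ : NonZero k}} → b ≡ 0 → + b ℚ./ k ℚ.≃ 0ℚᵘ
    zero/ .0 (suc k) refl = *≡* refl

-- Cylinders and degrees in powers of a graph

cylinder : ∀ {m} M → Subset m → Subset (m ℕ.* M)
cylinder M A = concat (Vec.map (replicate M) A)

∣++∣ : ∀ {m n} (p : Subset m) (q : Subset n) → ∣ p Vec.++ q ∣ ≡ ∣ p ∣ ℕ.+ ∣ q ∣
∣++∣ []          q = refl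
∣++∣ (true  ∷ p) q = cong suc (∣++∣ p q)
∣++∣ (false ∷ p) q = ∣++∣ p q

∣cylinder∣ : ∀ {m} M (A : Subset m) → ∣ cylinder M A ∣ ≡ ∣ A ∣ ℕ.* M
∣cylinder∣ M []          = refl
∣cylinder∣ M (true  ∷ A) = trans (∣++∣ (replicate M inside) (cylinder M A))
  (cong₂ ℕ._+_ (Subset.∣⊤∣≡n M) (∣cylinder∣ M A))
∣cylinder∣ M (false ∷ A) = trans (∣++∣ (replicate M outside) (cylinder M A))
  (cong₂ ℕ._+_ (Subset.∣⊥∣≡0 M) (∣cylinder∣ M A))

-- For `M = m ^ n`, `finToFun` reads the first coordinate of a vertex of the power as its quotient
-- by `M`. The constant blocks of length `M` are thus the fibres of the first coordinate.
lookup-cylinder : ∀ {m} M (A : Subset m) u → lookup (cylinder M A) u ≡ lookup A (quotient M u)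
lookup-cylinder {m} M A u = trans
  (cong (lookup (cylinder M A)) (sym (Fin.combine-remQuot {m} M u)))
  (trans (Vec.lookup-concat (Vec.map (replicate M) A) (quotient M u) (remainder {m} M u))
    (trans (cong (λ v → lookup v (remainder {m} M u)) (Vec.lookup-map (quotient M u) (replicate M) A))
      (Vec.lookup-replicate (remainder {m} M u) _)))

∈-cylinder⁺ : ∀ {m} M {A : Subset m} {u} → quotient M u ∈ A → u ∈ cylinder M A
∈-cylinder⁺ M {A} {u} h = Vec.lookup⇒[]= u (cylinder M A) (trans (lookup-cylinder M A u) (Vec.[]=⇒lookup h))

∈-cylinder⁻ : ∀ {m} M {A : Subset m} {u} → u ∈ cylinder M A → quotient M u ∈ A
∈-cylinder⁻ M {A} {u} h = Vec.lookup⇒[]= (quotient M u) A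
  (trans (sym (lookup-cylinder M A u)) (Vec.[]=⇒lookup h))

remQuot-injective : ∀ {m} M (u v : Fin (m ℕ.* M)) →
  quotient {m} M u ≡ quotient M v → remainder {m} M u ≡ remainder {m} M v → u ≡ v
remQuot-injective {m} M u v p q = trans (sym (Fin.combine-remQuot {m} M u))
  (trans (cong₂ combine p q) (Fin.combine-remQuot {m} M v))

finToFun-injective : ∀ {m} n (u v : Fin (m ℕ.^ n)) →
  (∀ l → finToFun {m} {n} u l ≡ finToFun v l) → u ≡ v
finToFun-injective zero    zero zero _ = refl
finToFun-injective {m} (suc n) u v h = remQuot-injective {m} (m ℕ.^ n) u v (h zero)
  (finToFun-injective n (remainder {m} (m ℕ.^ n) u) (remainder {m} (m ℕ.^ n) v) (h ∘ suc))

module _ {m} (G : Graph m) (n : ℕ) where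
  open Graph G

  -- An edge leaving a cylinder moves the first coordinate only.
  boundary-cylinder : ∀ A →
    boundary (G □^ suc n) (cylinder (m ℕ.^ n) A) ℕ.≤ boundary G A ℕ.* m ℕ.^ n
  boundary-cylinder A = ℕ.≤-trans
    (length-≤ split (crossing-unique (G □^ suc n) (cylinder M A)) split∈ split-injective)
    (ℕ.≤-reflexive (trans (length-cartesianProduct (crossing G A) (allFin M))
      (cong (boundary G A ℕ.*_) (length-allFin M))))
    where
    M : ℕ
    M = m ℕ.^ n
    split : Fin (m ℕ.* M) × Fin (m ℕ.* M) → (Fin m × Fin m) × Fin M
    -- Both endpoints have the same remainder, so one copy of it suffices to recover the edge.
    split (u , v) = (quotient M u , quotient M v) , remainder {m} M u
    edge : ∀ {u v} → (u , v) ∈ˡ crossing (G □^ suc n) (cylinder M A) →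
      quotient M u ∈ A × quotient M v ∉ A × Adj (quotient M u) (quotient M v)
        × remainder {m} M u ≡ remainder {m} M v
    edge {u} {v} uv∈ with ∈-crossing⁻ (G □^ suc n) uv∈
    ... | u∈ , v∉ , (zero , e , same) = ∈-cylinder⁻ M u∈ , v∉ ∘ ∈-cylinder⁺ M , e
        , finToFun-injective n (remainder {m} M u) (remainder {m} M v) (λ l → same (suc l) λ ())
    ... | u∈ , v∉ , (suc j , e , same) = contradiction
        (∈-cylinder⁺ M {A} {v} (subst (_∈ A) (same zero λ ()) (∈-cylinder⁻ M u∈))) v∉
    split∈ : ∀ {e} → e ∈ˡ crossing (G □^ suc n) (cylinder M A) →
             split e ∈ˡ cartesianProduct (crossing G A) (allFin M)
    split∈ {u , v} uv∈ = let (u∈ , v∉ , e , _) = edge uv∈ in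
      ∈-cartesianProduct⁺ (∈-crossing⁺ G u∈ v∉ e) (∈-allFin (remainder {m} M u))
    split-injective : ∀ {e e′} → e ∈ˡ crossing (G □^ suc n) (cylinder M A) →
      e′ ∈ˡ crossing (G □^ suc n) (cylinder M A) → split e ≡ split e′ → e ≡ e′
    split-injective {u , v} {u′ , v′} p q eq =
      let (_ , _ , _ , r)  = edge p
          (_ , _ , _ , r′) = edge q
      in cong₂ _,_
        (remQuot-injective {m} M u u′ (cong (proj₁ ∘ proj₁) eq) (cong proj₂ eq))
        (remQuot-injective {m} M v v′ (cong (proj₂ ∘ proj₁) eq)
          (trans (sym r) (trans (cong proj₂ eq) r′)))

  i-cylinder : ∀ k .{{_ : NonZero k}} .{{_ : NonZero (k ℕ.* m ℕ.^ n)}} → k ℕ.≤ m →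
    i (G □^ suc n) (k ℕ.* m ℕ.^ n) ℚ.≤ i G k
  i-cylinder k k≤m =
    let (A , ∣A∣≡k , e) = i-attained G k k≤m
    in ℚ.≤-trans
      (i≤ (G □^ suc n) (cylinder M A) (k ℕ.* M)
        (trans (∣cylinder∣ M A) (cong (ℕ._* M) ∣A∣≡k)))
      (subst (+ boundary (G □^ suc n) (cylinder M A) ℚ./ (k ℕ.* M) ℚ.≤_) (sym e)
        (cancel (boundary-cylinder A)))
    where
    M : ℕ
    M = m ℕ.^ n
    cross : ∀ {a b} k k′ .{{_ : NonZero k}} .{{_ : NonZero k′}} →
      a ℕ.* k′ ℕ.≤ b ℕ.* k → + a ℚ./ k ℚ.≤ + b ℚ./ k′
    cross {a} {b} (suc k) (suc k′) h = *≤*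
      (subst₂ ℤ._≤_ (ℤ.pos-* a (suc k′)) (ℤ.pos-* b (suc k)) (ℤ.+≤+ h))
    cancel : ∀ {a b} → a ℕ.≤ b ℕ.* M → + a ℚ./ (k ℕ.* M) ℚ.≤ + b ℚ./ k
    cancel {a} {b} h = cross (k ℕ.* M) k (ℕ.≤-trans (ℕ.*-monoˡ-≤ k h)
      (ℕ.≤-reflexive (trans (ℕ.*-assoc b M k) (cong (b ℕ.*_) (ℕ.*-comm M k)))))

-- There are `n * d` pairs `(j , w)` with `w` adjacent to coordinate `j` of `u`; overwriting
-- coordinate `j` by `w` sends them to distinct neighbours of `u`.
degree-power : ∀ {m} (G : Graph m) n d → (∀ v → degree G v ≡ d) →
               ∀ u → n ℕ.* d ℕ.≤ degree (G □^ n) u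
degree-power {m} G n d regular u = ℕ.≤-trans
  (ℕ.≤-reflexive (sym (trans
    (length-filter-cartesianProduct moves? d (allFin n) (allFin m) (regular ∘ x))
    (cong (ℕ._* d) (length-allFin n)))))
  (length-≤ move
    (Unique.filter⁺ moves? (Unique.cartesianProduct⁺ (Unique.allFin⁺ n) (Unique.allFin⁺ m)))
    (λ {(j , w)} jw∈ → ∈-neighbours⁺ (G □^ n)
      (j , subst (Adj (x j)) (sym (move-moved j w)) (adjacent jw∈) , λ l l≢j → sym (move-fixed j w l l≢j)))
    λ {jw} {kz} p q → move-injective {jw} {kz} (adjacent p) (adjacent q))
  where
  open Graph G
  x : Fin n → Fin m
  x = finToFun u
  moves? : Decidable (λ (e : Fin n × Fin m) → Adj (x (proj₁ e)) (proj₂ e))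
  moves? (j , w) = adj? (x j) w
  adjacent : ∀ {j w} → (j , w) ∈ˡ filter moves? (cartesianProduct (allFin n) (allFin m)) → Adj (x j) w
  adjacent jw∈ = proj₂ (∈-filter⁻ moves? {xs = cartesianProduct (allFin n) (allFin m)} jw∈)
  move : Fin n × Fin m → Fin (m ℕ.^ n)
  move (j , w) = funToFin (updateAt x j (const w))
  move-moved : ∀ j w → finToFun (move (j , w)) j ≡ w
  move-moved j w = trans (Fin.finToFun-funToFin (updateAt x j (const w)) j) (updateAt-updates j x)
  move-fixed : ∀ j w l → l ≢ j → finToFun (move (j , w)) l ≡ x l
  move-fixed j w l l≢j = trans (Fin.finToFun-funToFin (updateAt x j (const w)) l) (updateAt-minimal l j x l≢j)
  move-injective : ∀ {jw kz} → Adj (x (proj₁ jw)) (proj₂ jw) → Adj (x (proj₁ kz)) (proj₂ kz) →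
                   move jw ≡ move kz → jw ≡ kz
  move-injective {j , w} {k , z} e e′ eq with j Fin.≟ k
  ... | yes refl = cong (j ,_) (trans (sym (move-moved j w))
        (trans (cong (λ v → finToFun v j) eq) (move-moved j z)))
  -- Only the first move changes coordinate `j`, so equal results would make `w` the old value
  -- there, a loop in `G`.
  ... | no  j≢k  = contradiction e (irrefl (trans (sym (move-fixed k z j j≢k))
        (trans (cong (λ v → finToFun v j) (sym eq)) (move-moved j w))))

-- Cycles

next : ∀ {m} (u : Fin m) → ∃[ v ] Next u v
next {suc m} u with suc (toℕ u) ℕ.<? suc m
... | yes u<m = fromℕ< u<m , inj₁ (sym (Fin.toℕ-fromℕ< u<m))
... | no  u≮m = zero , inj₂ (ℕ.≤-antisym (Fin.toℕ<n u) (ℕ.≮⇒≥ u≮m) , refl)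

prev : ∀ {m} (v : Fin m) → ∃[ u ] Next u v
prev {suc m} zero    = Fin.fromℕ m , inj₂ (cong suc (Fin.toℕ-fromℕ m) , refl)
prev {suc m} (suc v) = inject₁ v , inj₁ (cong suc (Fin.toℕ-inject₁ v))

Next-functional : ∀ {m} {u v v′ : Fin m} → Next u v → Next u v′ → v ≡ v′
Next-functional (inj₁ p) (inj₁ q) = Fin.toℕ-injective (trans (sym p) q)
Next-functional {v = v} (inj₁ p) (inj₂ (q , _)) =
  contradiction (trans (sym p) q) (ℕ.<⇒≢ (Fin.toℕ<n v))
Next-functional {v′ = v′} (inj₂ (p , _)) (inj₁ q) =
  contradiction (trans (sym q) p) (ℕ.<⇒≢ (Fin.toℕ<n v′))
Next-functional (inj₂ (_ , p)) (inj₂ (_ , q)) = Fin.toℕ-injective (trans p (sym q))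

Next-injective : ∀ {m} {u u′ v : Fin m} → Next u v → Next u′ v → u ≡ u′
Next-injective (inj₁ p) (inj₁ q) = Fin.toℕ-injective (ℕ.suc-injective (trans p (sym q)))
Next-injective (inj₁ p) (inj₂ (_ , q)) = contradiction (trans p q) λ ()
Next-injective (inj₂ (_ , p)) (inj₁ q) = contradiction (trans q p) λ ()
Next-injective (inj₂ (p , _)) (inj₂ (q , _)) = Fin.toℕ-injective (ℕ.suc-injective (trans p (sym q)))

-- Makes the successor and the predecessor of a vertex distinct, so that the degree is 2; on two
-- vertices they would coincide.
Next-asym : ∀ {m} → 3 ℕ.≤ m → {u v : Fin m} → Next u v → ¬ Next v u
Next-asym _   {u} (inj₁ p) (inj₁ q) =
  ℕ.m≢1+n+m (toℕ u) {1} (sym (trans (cong suc p) q))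
Next-asym 3≤m (inj₁ p) (inj₂ (q , z)) =
  contradiction (subst (3 ℕ.≤_) (trans (sym q) (cong suc (trans (sym p) (cong suc z)))) 3≤m)
    λ { (s≤s (s≤s ())) }
Next-asym 3≤m (inj₂ (p , z)) (inj₁ q) =
  contradiction (subst (3 ℕ.≤_) (trans (sym p) (cong suc (trans (sym q) (cong suc z)))) 3≤m)
    λ { (s≤s (s≤s ())) }
Next-asym 3≤m (inj₂ (p , _)) (inj₂ (_ , z)) =
  contradiction (subst (3 ℕ.≤_) (trans (sym p) (cong suc z)) 3≤m) λ { (s≤s ()) }

module Cycle (m : ℕ) (3≤m : 3 ℕ.≤ m) where

  C : Graph m
  C = cycle m 3≤m

  open Graph C

  cycle-degree : ∀ v → degree C v ≡ 2
  cycle-degree v = ℕ.≤-antisym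
    (length-≤ (λ w → w) {ys = w₁ ∷ w₂ ∷ []} (neighbours-unique C v) (λ w∈ → either (∈-neighbours⁻ C w∈))
      λ _ _ e → e)
    (length-≤ (λ w → w) {w₁ ∷ w₂ ∷ []} ((w₁≢w₂ ∷ []) ∷ [] ∷ [])
      (λ { (here refl) → ∈-neighbours⁺ C (inj₁ p₁) ; (there (here refl)) → ∈-neighbours⁺ C (inj₂ p₂) })
      λ _ _ e → e)
    where
    w₁ w₂ : Fin m
    w₁ = proj₁ (next v)
    w₂ = proj₁ (prev v)
    p₁ : Next v w₁
    p₁ = proj₂ (next v)
    p₂ : Next w₂ v
    p₂ = proj₂ (prev v)
    w₁≢w₂ : w₁ ≢ w₂
    w₁≢w₂ e = Next-asym 3≤m p₁ (subst (λ w → Next w v) (sym e) p₂)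
    either : ∀ {w} → Adj v w → w ∈ˡ w₁ ∷ w₂ ∷ []
    either (inj₁ p) = here (Next-functional p p₁)
    either (inj₂ p) = there (here (Next-injective p p₂))

  cycle-regular : Regular C
  cycle-regular = 2 , cycle-degree

  private
    origin : Fin m
    origin = fromℕ< (ℕ.≤-trans (s≤s z≤n) 3≤m)

    descend : ∀ k (u : Fin m) → toℕ u ≡ k → Star Adj u origin
    descend zero    u e = subst (Star Adj u)
      (Fin.toℕ-injective (trans e (sym (Fin.toℕ-fromℕ< (ℕ.≤-trans (s≤s z≤n) 3≤m))))) Star.ε
    descend (suc k) u e with prev u
    ... | w , inj₁ p       = inj₂ (inj₁ p) ◅ descend k w (ℕ.suc-injective (trans p e))
    ... | w , inj₂ (_ , z) = contradiction (trans (sym e) z) λ ()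

  cycle-connected : Connected C
  cycle-connected = origin , λ u v →
    descend (toℕ u) u refl ◅◅ reverse symm (descend (toℕ v) v refl)

-- The witness is the arc formed by vertices 0 and 1. Only the edges from 0 to the last vertex and
-- from 1 to 2 leave it.
i₂-cycle : ∀ m (3≤m : 3 ℕ.≤ m) → 5 ℕ.≤ m → i (cycle m 3≤m) 2 ℚ.≤ 1ℚᵘ
i₂-cycle m@(suc (suc m₂)) 3≤m 5≤m = ℚ.≤-trans
  (i≤ C A 2 (cong (λ k → suc (suc k)) (Subset.∣⊥∣≡0 m₂)))
  (half≤1 (length-≤ (λ (u , v) → toℕ u , toℕ v) {ys = (0 , suc m₂) ∷ (1 , 2) ∷ []} (crossing-unique C A)
    (λ uv∈ → let (u∈ , v∉ , e) = ∈-crossing⁻ C uv∈ in ends u∈ v∉ e)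
    λ _ _ e → cong₂ _,_ (Fin.toℕ-injective (cong proj₁ e)) (Fin.toℕ-injective (cong proj₂ e))))
  where
  C : Graph m
  C = cycle m 3≤m
  A : Subset m
  A = inside ∷ inside ∷ ⊥
  half≤1 : ∀ {b} → b ℕ.≤ 2 → + b ℚ./ 2 ℚ.≤ 1ℚᵘ
  half≤1 {0} _ = *≤* (ℤ.+≤+ z≤n)
  half≤1 {1} _ = *≤* (ℤ.+≤+ (s≤s z≤n))
  half≤1 {2} _ = *≤* (ℤ.+≤+ (s≤s (s≤s z≤n)))
  half≤1 {suc (suc (suc _))} (s≤s (s≤s ()))
  ends : ∀ {u v} → u ∈ A → v ∉ A → Graph.Adj C u v →
         (toℕ u , toℕ v) ∈ˡ (0 , suc m₂) ∷ (1 , 2) ∷ []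
  ends {zero}         {zero}        _ v∉ _ = contradiction here v∉
  ends {zero}         {suc zero}    _ v∉ _ = contradiction (there here) v∉
  ends {suc zero}     {zero}        _ v∉ _ = contradiction here v∉
  ends {suc zero}     {suc zero}    _ v∉ _ = contradiction (there here) v∉
  ends {suc (suc u)}  (there (there u∈)) _ _ = contradiction u∈ Subset.∉⊥
  ends {zero}     {suc (suc v)} _ _ (inj₁ (inj₁ ()))
  ends {zero}     {suc (suc v)} _ _ (inj₁ (inj₂ (_ , ())))
  ends {zero}     {suc (suc v)} _ _ (inj₂ (inj₁ ()))
  ends {zero}     {suc (suc v)} _ _ (inj₂ (inj₂ (e , _))) = here (cong (0 ,_) (ℕ.suc-injective e))
  ends {suc zero} {suc (suc v)} _ _ (inj₁ (inj₁ e))       = there (here (cong (1 ,_) (sym e)))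
  ends {suc zero} {suc (suc v)} _ _ (inj₁ (inj₂ (_ , ())))
  ends {suc zero} {suc (suc v)} _ _ (inj₂ (inj₁ ()))
  ends {suc zero} {suc (suc v)} _ _ (inj₂ (inj₂ (_ , ())))
i₂-cycle (suc zero) (s≤s ()) _

fromℚ-mono : ∀ {p q} → p ℚ.≤ q → fromℚ p ≤ fromℚ q
fromℚ-mono h = ≤ᴿ-eventually (always λ _ → h)

cycle-notLinear : ∀ m (3≤m : 3 ℕ.≤ m) → 5 ℕ.≤ m → MinorantNotLinear (cycle m 3≤m)
cycle-notLinear m 3≤m 5≤m = ψ , minorant , λ affine → positive⇒≰0 (logℕ-< 4 m 5≤m)
  -- The summands are the links of `2 (L - l) ≤ i₁ (L - l) ≤ i₂ L ≤ L`, followed by `l + l ≤ log 4`.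
  -- The resulting `L ≤ log 4` would hold for `m = 4`, which is why 5 is the threshold.
  (≤-via ((1ℝ - i₂) * L + (i₁ - fromℚ (+ 2 ℚ./ 1)) * (L - l)
          + (i₂ * L - i₁ * (L - l)) + (logℕ 4 - (l + l)))
    (0≤+ (0≤+ (0≤+ (0≤* (0≤y-x (fromℚ-mono (i₂-cycle m 3≤m 5≤m))) 0≤L)
        (0≤* (0≤y-x (fromℚ-mono (i₁-≥ C 2 1≤m λ u → ℕ.≤-reflexive (sym (cycle-degree u)))))
          (0≤y-x (logℕ-mono 2 m 2≤m))))
      (0≤y-x (affine⇒above-chord (λ k → fromℚ-mono (0≤i C k)) affine 2 2≤m)))
      (0≤y-x (≈⇒≤ (≈-sym (logℕ-* 2 2)))))
    λ n → solve 5 (λ L l l₄ i₁ i₂ → (L :- l₄) :+ ((con 1ℚᵘ :- i₂) :* L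
        :+ (i₁ :- con (+ 2 ℚ./ 1)) :* (L :- l)
        :+ (i₂ :* L :- i₁ :* (L :- l)) :+ (l₄ :- (l :+ l))) := con 0ℚᵘ)
      ℚ.≃-refl (seq L n) (seq l n) (seq (logℕ 4) n) (i C 1) (i C 2))
  where
  open Cycle m 3≤m using (C; cycle-degree)
  2≤m : 2 ℕ.≤ m
  2≤m = ℕ.<⇒≤ 3≤m
  1≤m : 1 ℕ.≤ m
  1≤m = ℕ.<⇒≤ 2≤m
  ψ : ℝ → ℝ
  ψ = proj₁ (convexMinorant C 2≤m)
  minorant : IsConvexMinorant C ψ
  minorant = proj₂ (convexMinorant C 2≤m)
  open Minorant C 2≤m ψ minorant
  L l i₁ i₂ : ℝ
  L  = logℕ m
  l  = logℕ 2
  i₁ = fromℚ (i C 1)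
  i₂ = fromℚ (i C 2)

-- Powers of a graph

logℕ-^ : ∀ m n .{{_ : NonZero m}} → logℕ (m ℕ.^ n) ≈ fromℚ (+ n ℚ./ 1) * logℕ m
logℕ-^ m zero    = ≈-trans log1≈0 (≈-pointwise λ n → ℚ.≃-sym (ℚ.*-zeroˡ (seq (logℕ m) n)))
logℕ-^ m (suc n) = ≈-trans (logℕ-* m (m ℕ.^ n) {{it}} {{m^n≢0}} {{ℕ.m*n≢0 m (m ℕ.^ n) {{it}} {{m^n≢0}}}})
  (≈-trans (+ᴿ-cong (≈-refl {logℕ m}) (logℕ-^ m n))
    (≈-pointwise λ k → ℚ.≃-sym (LogProofs.nat-suc n (seq (logℕ m) k))))
  where
  m^n≢0 : NonZero (m ℕ.^ n)
  m^n≢0 = ℕ.m^n≢0 m n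

power-notLinear : ∀ m (G : Graph m) → 2 ℕ.≤ m → Connected G → Regular G → MinorantNotLinear G →
  ∀ n → 1 ℕ.≤ n →
  ¬ (∃[ c ] ∃[ C ] (∀ a .{{_ : NonZero a}} → a ℕ.≤ m ℕ.^ n →
    fromℚ (i (G □^ n) a) ≈ c * log (+ (m ℕ.^ n) ℚ./ a) + C))
power-notLinear m G 2≤m (v , _) (d , regular) (ψ , minorant , ¬affine) (suc n) _ (c , C , h) =
  ¬affine (above-chord⇒affine c
    (λ k k≤m → ≤ᴿ-trans {y = c * (L - logℕ k) + C}
      -- Only `0 ≤ C` matters here; `C ≤ 0` serves in `d≤cL`.
      (≤-via C 0≤C λ _ → ℚ.≃-refl)
      (≤ᴿ-respˡ (profile k k≤m) (fromℚ-mono (i-cylinder G n k {{it}} {{nz k}} k≤m))))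
    (≤ᴿ-trans (fromℚ-mono (ℚ.≤-trans (i₁-≤ G v) (ℚ.≤-reflexive (ℚ.≃-reflexive
      (cong (λ d → + d ℚ./ 1) (regular v)))))) d≤cL)
    (fromℚ-mono (iₘ-≤ G)))
  where
  open Minorant G 2≤m ψ minorant
  instance
    m≢0 : NonZero m
    m≢0 = ℕ.>-nonZero (ℕ.≤-trans (s≤s z≤n) 2≤m)
    M≢0 : NonZero (m ℕ.^ n)
    M≢0 = ℕ.m^n≢0 m n
  M : ℕ
  M = m ℕ.^ n
  L : ℝ
  L = logℕ m
  nz : ∀ k .{{_ : NonZero k}} → NonZero (k ℕ.* M)
  nz k = ℕ.m*n≢0 k M
  profile : ∀ k .{{_ : NonZero k}} → k ℕ.≤ m →
    fromℚ (i (G □^ suc n) (k ℕ.* M) {{nz k}}) ≈ c * (L - logℕ k) + C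
  -- `m ^ suc n` unfolds to `m * M`, so the common factor `M` cancels inside the logarithm.
  profile k k≤m = ≈-trans (h (k ℕ.* M) {{nz k}} (ℕ.*-monoˡ-≤ M k≤m))
    (+ᴿ-cong (*ᴿ-congˡ c (log-ratio m k M {{it}} {{it}} {{it}} {{nz m}} {{nz k}})) (≈-refl {C}))
  profileₘ : fromℚ (i (G □^ suc n) (m ℕ.* M) {{nz m}}) ≈ C
  profileₘ = ≈-trans (profile m ℕ.≤-refl) (≈-pointwise λ k →
    solve 3 (λ c l C → c :* (l :- l) :+ C := C) ℚ.≃-refl (seq c k) (seq L k) (seq C k))
  0≤C : 0ℝ ≤ C
  0≤C = ≤ᴿ-respʳ profileₘ (fromℚ-mono (0≤i (G □^ suc n) (m ℕ.* M) {{nz m}}))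
  C≤0 : C ≤ 0ℝ
  C≤0 = ≤ᴿ-respˡ profileₘ
    (fromℚ-mono (ℚ.≤-trans (i-cylinder G n m {{it}} {{nz m}} ℕ.≤-refl) (iₘ-≤ G)))
  u : ℝ
  u = fromℚ (+ suc n ℚ./ 1)
  u>0 : Positive u
  u>0 = mkPositive (+ suc n ℚ./ 1) (ℚ.positive⁻¹ (+ suc n ℚ./ 1)) (always λ _ → ℚ.≤-refl)
  -- At size 1 the assumed formula gives `u d ≤ c log (m ^ suc n) + C ≤ u c L`, and the factor
  -- `u = n + 1` cancels.
  d≤cL : fromℚ (+ d ℚ./ 1) ≤ c * L
  d≤cL = *-cancel-≤ {u} (recip u>0) (≤ᴿ-trans {y = fromℚ (i (G □^ suc n) 1)}
    (≤ᴿ-eventually (always λ _ → ℚ.≤-trans (ℚ.≤-reflexive (*≡* (cong (ℤ._* + 1)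
        (trans (sym (ℤ.pos-* d (suc n))) (cong +_ (ℕ.*-comm d (suc n)))))))
      (i₁-≥ (G □^ suc n) (suc n ℕ.* d) (ℕ.m^n>0 m (suc n)) (degree-power G (suc n) d regular))))
    (≤ᴿ-trans (≈⇒≤ (h 1 (ℕ.m^n>0 m (suc n))))
      (≤-via {c * logℕ (m ℕ.^ suc n) + C} ((u * L - logℕ (m ℕ.^ suc n)) * c + (0ℝ - C))
        (0≤+ (≈⇒≤ (≈-sym (null-* (x-y≈0 (≈-sym (logℕ-^ m (suc n))))))) (0≤y-x C≤0))
        λ k → solve 5 (λ c C l u L →
            (c :* l :+ C) :+ ((u :* L :- l) :* c :+ (con 0ℚᵘ :- C)) := (c :* L) :* u)
          ℚ.≃-refl (seq c k) (seq C k) (seq (logℕ (m ℕ.^ suc n)) k) (+ suc n ℚ./ 1) (seq L k))))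

mainTheorem5 : (∀ m (G : Graph m) → 2 ℕ.≤ m → Connected G → Regular G → MinorantNotLinear G →
    ∀ n → 1 ℕ.≤ n →
    ¬ (∃[ c ] ∃[ C ] (∀ a .{{_ : NonZero a}} → a ℕ.≤ m ℕ.^ n →
    fromℚ (i (G □^ n) a) ≈ c * log (+ (m ℕ.^ n) ℚ./ a) + C)))
    × (∃[ m ] Σ[ G ∈ Graph m ]
    (2 ℕ.≤ m × Connected G × Regular G × MinorantNotLinear G))
    × (∀ m (5≤m : 5 ℕ.≤ m) → let C = cycle m (≤-trans (m≤n+m 3 2) 5≤m) in
    Connected C × Regular C × MinorantNotLinear C)
mainTheorem5 = power-notLinear
  , (5 , cycle 5 (m≤n+m 3 2) , m≤n+m 2 3 , cycle-facts 5 (m≤n+m 3 2) ℕ.≤-refl)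
  , λ m 5≤m → cycle-facts m (≤-trans (m≤n+m 3 2) 5≤m) 5≤m
  where
  cycle-facts : ∀ m (3≤m : 3 ℕ.≤ m) → 5 ℕ.≤ m →
    Connected (cycle m 3≤m) × Regular (cycle m 3≤m) × MinorantNotLinear (cycle m 3≤m)
  cycle-facts m 3≤m 5≤m = cycle-connected , cycle-regular , cycle-notLinear m 3≤m 5≤m
    where open Cycle m 3≤m
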